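{- $\mathbf{GR}^\circ$ enjoys uniform interpolation property: for every $\mathcal{L}_2$-formula $A$ and every finite set $P$ of propositional variables there is an $\mathcal{L}_2$-formula $C$ such that (1) $v(C)\subseteq v(A)\setminus P$; (2) $\mathbf{GR}^\circ\vdash A\to C$; (3) for every $\mathcal{L}_2$-formula $B$, if $\mathbf{GR}^\circ\vdash A\to B$ and $v(B)\cap P=\emptyset$, then $\mathbf{GR}^\circ\vdash C\to B$.
   Context: $\mathcal{L}_2$ is the bimodal propositional language with countably many propositional variables, $\bot$, connectives $\neg,\vee$ (others defined), and unary modal operators $\Box,\blacksquare$; $\Diamond$ abbreviates $\neg\Box\neg$; $v(A)$ denotes the set of propositional variables occurring in $A$. The logic $\mathbf{GR}^-$ has as axioms all propositional tautologies of $\mathcal{L}_2$ and all instances of $\Box(A\to B)\to(\Box A\to\Box B)$, $\Box(\Box A\to A)\to\Box A$, $\blacksquare A\to\Box A$, $\Box A\to\Box\blacksquare A$, $\Box A\to(\Box\bot\vee\blacksquare A)$, $\Diamond\blacksquare A\to\Diamond A$, and rules modus ponens and $\Box$-necessitation. $\mathbf{GR}^\circ$ is $\mathbf{GR}^-$ plus the rule: from $A$ infer $\blacksquare A$. -}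

module Defs where

open import Data.Nat using (ℕ)
open import Data.Bool using (Bool; true; false; not; _∨_)
open import Data.List using (List)
open import Data.List.Membership.Propositional using (_∈_)
open import Relation.Binary.PropositionalEquality using (_≡_)
open import Data.Product using (_×_)
open import Data.Sum using (_⊎_)
open import Relation.Nullary using (¬_)

data Form : Set where
  var : ℕ → Form
  ⊥'  : Form
  ¬'_ : Form → Form
  _∨'_ : Form → Form → Form
  □_  : Form → Form
  ■_  : Form → Form

infixr 6 _∨'_
infixr 5 _⇒_
infix 7 ¬'_ □_ ■_ ◇_

_⇒_ : Form → Form → Form
A ⇒ B = (¬' A) ∨' B

◇_ : Form → Form
◇ A = ¬' (□ (¬' A))

data _occursIn_ (p : ℕ) : Form → Set where
  here  : p occursIn var p
  in¬   : ∀ {A} → p occursIn A → p occursIn (¬' A)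
  in∨ˡ  : ∀ {A B} → p occursIn A → p occursIn (A ∨' B)
  in∨ʳ  : ∀ {A B} → p occursIn B → p occursIn (A ∨' B)
  in□   : ∀ {A} → p occursIn A → p occursIn (□ A)
  in■   : ∀ {A} → p occursIn A → p occursIn (■ A)

-- Propositional evaluation: modalised formulas □A, ■A are treated as atoms.
eval : (ℕ → Bool) → (Form → Bool) → Form → Bool
eval σ τ (var p) = σ p
eval σ τ ⊥' = false
eval σ τ (¬' A) = not (eval σ τ A)
eval σ τ (A ∨' B) = eval σ τ A ∨ eval σ τ B
eval σ τ (□ A) = τ (□ A)
eval σ τ (■ A) = τ (■ A)

Tautology : Form → Set
Tautology A = ∀ (σ : ℕ → Bool) (τ : Form → Bool) → eval σ τ A ≡ true

data GR° : Form → Set where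
  taut  : ∀ {A} → Tautology A → GR° A
  axK   : ∀ {A B} → GR° (□ (A ⇒ B) ⇒ (□ A ⇒ □ B))
  axL   : ∀ {A} → GR° (□ (□ A ⇒ A) ⇒ □ A)
  ax■□  : ∀ {A} → GR° (■ A ⇒ □ A)
  ax□□■ : ∀ {A} → GR° (□ A ⇒ □ (■ A))
  ax□⊥  : ∀ {A} → GR° (□ A ⇒ (□ ⊥' ∨' ■ A))
  ax◇■  : ∀ {A} → GR° (◇ (■ A) ⇒ ◇ A)
  mp    : ∀ {A B} → GR° (A ⇒ B) → GR° A → GR° B
  nec□  : ∀ {A} → GR° A → GR° (□ A)
  nec■  : ∀ {A} → GR° A → GR° (■ A)

{-# OPTIONS --safe #-}
module Submission where

-- A type t over the atoms of A fixes the truth values of the variables, boxes □E and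
-- black boxes ■D relevant to A. In a finite tree model ■ coincides with □ except at
-- endpoints, where ■D is a free atom unless the parent forces □D or □¬D (or D is a theorem
-- and the endpoint is the root). For every type t a formula e t over the allowed variables
-- is defined by recursion on the number of boxes false at t: it says that the P-free atoms
-- are as in t, that every false □E is refuted in some e r with r a successor of t at which
-- □E is true (Löb), and that above only types compatible with t occur. For successors s with
-- the same boxes as t only the non-recursive part of e s is mentioned, since the missing
-- part □Z of e s is shared with e t and is inherited upwards.
-- The interpolant is the disjunction of e t over the types t satisfying A. If e t is
-- consistent with a type u over the P-free atoms of B, then one tree realises t and u at once,
-- so that A ⇒ B is not provable when t satisfies A and u refutes B.

open import Defs
open import Data.Nat using (ℕ; zero; suc; _+_; _≤_; _<_; z≤n; s≤s; _<?_)
import Data.Nat.Properties as ℕₚ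
open import Data.Bool using (Bool; true; false; not; _∧_; _∨_)
import Data.Bool.Properties as Boolₚ
open import Data.List using (List; []; _∷_; _++_; map; filter; length)
open import Data.List.Relation.Unary.Any using (here; there)
open import Data.List.Membership.Propositional using (_∈_; _∉_)
open import Data.List.Membership.Propositional.Properties using (∈-++⁺ˡ; ∈-++⁺ʳ; ∈-++⁻; ∈-map⁺; ∈-map⁻; ∈-filter⁺; ∈-filter⁻)
import Data.List.Membership.DecPropositional as DecMembership
open import Data.Maybe using (Maybe; just; nothing)
open import Data.Product using (Σ; ∃; _×_; _,_; proj₁; proj₂)
open import Data.Sum using (_⊎_; inj₁; inj₂; [_,_]′)
open import Data.Unit using (⊤; tt)
open import Data.Empty using (⊥; ⊥-elim)
open import Function using (_∘_; id)
open import Relation.Nullary using (¬_; Dec; yes; no)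
open import Relation.Nullary.Decidable using (map′; _×-dec_; ¬?)
open import Relation.Binary.PropositionalEquality using (_≡_; refl; sym; trans; cong; cong₂; subst)

-- Decidable equality of formulas and Boolean case distinction.

infix 4 _≟F_
_≟F_ : (A B : Form) → Dec (A ≡ B)
var p ≟F var q = map′ (cong var) (λ { refl → refl }) (p ℕₚ.≟ q)
⊥' ≟F ⊥' = yes refl
(¬' A) ≟F (¬' B) = map′ (cong ¬'_) (λ { refl → refl }) (A ≟F B)
(A ∨' B) ≟F (C ∨' D) = map′ (λ { (refl , refl) → refl }) (λ { refl → refl , refl }) ((A ≟F C) ×-dec (B ≟F D))
(□ A) ≟F (□ B) = map′ (cong □_) (λ { refl → refl }) (A ≟F B)
(■ A) ≟F (■ B) = map′ (cong ■_) (λ { refl → refl }) (A ≟F B)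
var _ ≟F ⊥' = no λ ()
var _ ≟F (¬' _) = no λ ()
var _ ≟F (_ ∨' _) = no λ ()
var _ ≟F (□ _) = no λ ()
var _ ≟F (■ _) = no λ ()
⊥' ≟F var _ = no λ ()
⊥' ≟F (¬' _) = no λ ()
⊥' ≟F (_ ∨' _) = no λ ()
⊥' ≟F (□ _) = no λ ()
⊥' ≟F (■ _) = no λ ()
(¬' _) ≟F var _ = no λ ()
(¬' _) ≟F ⊥' = no λ ()
(¬' _) ≟F (_ ∨' _) = no λ ()
(¬' _) ≟F (□ _) = no λ ()
(¬' _) ≟F (■ _) = no λ ()
(_ ∨' _) ≟F var _ = no λ ()
(_ ∨' _) ≟F ⊥' = no λ ()
(_ ∨' _) ≟F (¬' _) = no λ ()
(_ ∨' _) ≟F (□ _) = no λ ()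
(_ ∨' _) ≟F (■ _) = no λ ()
(□ _) ≟F var _ = no λ ()
(□ _) ≟F ⊥' = no λ ()
(□ _) ≟F (¬' _) = no λ ()
(□ _) ≟F (_ ∨' _) = no λ ()
(□ _) ≟F (■ _) = no λ ()
(■ _) ≟F var _ = no λ ()
(■ _) ≟F ⊥' = no λ ()
(■ _) ≟F (¬' _) = no λ ()
(■ _) ≟F (_ ∨' _) = no λ ()
(■ _) ≟F (□ _) = no λ ()

bool : (b : Bool) → b ≡ true ⊎ b ≡ false
bool true = inj₁ refl
bool false = inj₂ refl

true≢false : {b : Bool} → b ≡ true → b ≡ false → ⊥
true≢false refl ()

-- Valuations and propositional reasoning

-- Only the values at variables and at formulas □A, ■A matter.
Val : Set
Val = Form → Bool

⟦_⟧ : Val → Form → Bool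
⟦ f ⟧ A = eval (λ p → f (var p)) f A

infix 3 _⊨_
-- A record rather than a bare equation: `⟦ f ⟧ A` computes, and the wrapper lets unification
-- recover `f` and `A`.
record _⊨_ (f : Val) (A : Form) : Set where
  constructor ⟨_⟩
  field holds : ⟦ f ⟧ A ≡ true
open _⊨_

module _ {f : Val} where

  ⊨? : ∀ A → f ⊨ A ⊎ ¬ (f ⊨ A)
  ⊨? A with bool (⟦ f ⟧ A)
  ... | inj₁ e = inj₁ ⟨ e ⟩
  ... | inj₂ e = inj₂ λ h → true≢false (holds h) e

  ¬i : ∀ {A} → ¬ (f ⊨ A) → f ⊨ ¬' A
  ¬i {A} h with bool (⟦ f ⟧ A)
  ... | inj₁ e = ⊥-elim (h ⟨ e ⟩)
  ... | inj₂ e = ⟨ cong not e ⟩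

  ¬e : ∀ {A} → f ⊨ ¬' A → ¬ (f ⊨ A)
  ¬e ⟨ n ⟩ ⟨ e ⟩ = true≢false n (cong not e)

  ∨l : ∀ {A B} → f ⊨ A → f ⊨ A ∨' B
  ∨l {B = B} ⟨ e ⟩ = ⟨ cong (_∨ ⟦ f ⟧ B) e ⟩

  ∨r : ∀ {A B} → f ⊨ B → f ⊨ A ∨' B
  ∨r {A} ⟨ e ⟩ = ⟨ trans (cong (⟦ f ⟧ A ∨_) e) (Boolₚ.∨-zeroʳ _) ⟩

  ∨e : ∀ {A B} → f ⊨ A ∨' B → f ⊨ A ⊎ f ⊨ B
  ∨e {A} {B} ⟨ e ⟩ with bool (⟦ f ⟧ A)
  ... | inj₁ a = inj₁ ⟨ a ⟩
  ... | inj₂ a = inj₂ ⟨ trans (sym (cong (_∨ ⟦ f ⟧ B) a)) e ⟩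

  ⇒i : ∀ {A B} → (f ⊨ A → f ⊨ B) → f ⊨ (A ⇒ B)
  ⇒i {A} h with ⊨? A
  ... | inj₁ a = ∨r (h a)
  ... | inj₂ n = ∨l (¬i n)

  ⇒e : ∀ {A B} → f ⊨ (A ⇒ B) → f ⊨ A → f ⊨ B
  ⇒e h a = [ (λ n → ⊥-elim (¬e n a)) , id ]′ (∨e h)

  ¬⊥ : ¬ (f ⊨ ⊥')
  ¬⊥ ⟨ () ⟩

  by-contra : ∀ {A} → ¬ (f ⊨ ¬' A) → f ⊨ A
  by-contra {A} h = [ id , (λ n → ⊥-elim (h (¬i n))) ]′ (⊨? A)

merge : (ℕ → Bool) → Val → Val
merge σ τ (var p) = σ p
merge σ τ A = τ A

eval-merge : ∀ σ τ A → ⟦ merge σ τ ⟧ A ≡ eval σ τ A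
eval-merge σ τ (var p) = refl
eval-merge σ τ ⊥' = refl
eval-merge σ τ (¬' A) = cong not (eval-merge σ τ A)
eval-merge σ τ (A ∨' B) = cong₂ _∨_ (eval-merge σ τ A) (eval-merge σ τ B)
eval-merge σ τ (□ A) = refl
eval-merge σ τ (■ A) = refl

infix 2 ⊢_
⊢_ : Form → Set
⊢_ = GR°

-- `Tautology` quantifies over two separate assignments, which `merge` joins into one valuation.
-- Propositional derivations can then be given as semantic arguments about `⊨`.
prop : ∀ {A} → (∀ {f} → f ⊨ A) → ⊢ A
prop {A} h = taut λ σ τ → trans (sym (eval-merge σ τ A)) (holds (h {merge σ τ}))

prop₁ : ∀ {A B} → ⊢ A → (∀ {f} → f ⊨ A → f ⊨ B) → ⊢ B
prop₁ a h = mp (prop (⇒i h)) a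

prop₂ : ∀ {A B C} → ⊢ A → ⊢ B → (∀ {f} → f ⊨ A → f ⊨ B → f ⊨ C) → ⊢ C
prop₂ a b h = mp (prop₁ a λ x → ⇒i (h x)) b

prop₃ : ∀ {A B C D} → ⊢ A → ⊢ B → ⊢ C → (∀ {f} → f ⊨ A → f ⊨ B → f ⊨ C → f ⊨ D) → ⊢ D
prop₃ a b c h = mp (prop₂ a b λ x y → ⇒i (h x y)) c

-- Derived propositional and modal rules.

infixr 5 _⟫_
_⟫_ : ∀ {A B C} → ⊢ A ⇒ B → ⊢ B ⇒ C → ⊢ A ⇒ C
p ⟫ q = prop₂ p q λ x y → ⇒i λ a → ⇒e y (⇒e x a)

weaken : ∀ {X A} → ⊢ A → ⊢ X ⇒ A
weaken p = prop₁ p λ x → ⇒i λ _ → x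

contrapose : ∀ {A B} → ⊢ A ⇒ ¬' B → ⊢ B ⇒ ¬' A
contrapose p = prop₁ p λ x → ⇒i λ b → ¬i λ a → ¬e (⇒e x a) b

□-map₂ : ∀ {X A B C} → ⊢ A ⇒ B ⇒ C → ⊢ X ⇒ □ A → ⊢ X ⇒ □ B → ⊢ X ⇒ □ C
□-map₂ p a b =
  prop₃ (a ⟫ mp axK (nec□ p)) axK b λ x k y → ⇒i λ h → ⇒e (⇒e k (⇒e x h)) (⇒e y h)

□-map : ∀ {X A B} → ⊢ A ⇒ B → ⊢ X ⇒ □ A → ⊢ X ⇒ □ B
□-map p a = a ⟫ mp axK (nec□ p)

□-trans : ∀ {A} → ⊢ □ A ⇒ □ □ A
□-trans = □-map ax■□ ax□□■

-- The contrapositive of `ax◇■`: a parent satisfying `□ (¬' D)` forces `■ D` to fail above it.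
□¬-■ : ∀ {A} → ⊢ □ (¬' A) ⇒ □ (¬' ■ A)
□¬-■ = prop₁ ax◇■ λ x → ⇒i λ n → by-contra λ m → ¬e (⇒e x m) n

-- Finite disjunctions and conjunctions, and guarded formulas.

module _ {X : Set} where

  ⋁ : List X → (X → Form) → Form
  ⋁ [] h = ⊥'
  ⋁ (x ∷ xs) h = h x ∨' ⋁ xs h

  ⋀ : List X → (X → Form) → Form
  ⋀ xs h = ¬' (⋁ xs (λ x → ¬' h x))

  ⋁-intro : ∀ {f xs h x} → x ∈ xs → f ⊨ h x → f ⊨ ⋁ xs h
  ⋁-intro (here refl) p = ∨l p
  ⋁-intro (there i) p = ∨r (⋁-intro i p)

  ⋁-elim : ∀ {f} xs {h} → f ⊨ ⋁ xs h → ∃ λ x → x ∈ xs × f ⊨ h x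
  ⋁-elim [] p = ⊥-elim (¬⊥ p)
  ⋁-elim (x ∷ xs) p with ∨e p
  ... | inj₁ q = x , here refl , q
  ... | inj₂ q = let y , i , r = ⋁-elim xs q in y , there i , r

  ⋀-intro : ∀ {f xs h} → (∀ x → x ∈ xs → f ⊨ h x) → f ⊨ ⋀ xs h
  ⋀-intro {xs = xs} p = ¬i λ q → let x , i , r = ⋁-elim xs q in ¬e r (p x i)

  ⋀-elim : ∀ {f xs h x} → f ⊨ ⋀ xs h → x ∈ xs → f ⊨ h x
  ⋀-elim p i = by-contra λ n → ¬e p (⋁-intro i n)

  ⋁-rule : ∀ {G} xs {h} → (∀ x → x ∈ xs → ⊢ h x ⇒ G) → ⊢ ⋁ xs h ⇒ G
  ⋁-rule [] p = prop (⇒i λ q → ⊥-elim (¬⊥ q))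
  ⋁-rule (x ∷ xs) p = prop₂ (p x (here refl)) (⋁-rule xs (λ y i → p y (there i)))
    λ a b → ⇒i λ q → [ ⇒e a , ⇒e b ]′ (∨e q)

  ⋀-rule : ∀ {G} xs {h} → (∀ x → x ∈ xs → ⊢ G ⇒ h x) → ⊢ G ⇒ ⋀ xs h
  ⋀-rule xs p = contrapose (⋁-rule xs λ x i → contrapose (p x i ⟫ prop (⇒i λ a → ¬i λ n → ¬e n a)))

  □⋁-rule : ∀ {Y G} xs {h} → (∀ x → x ∈ xs → ⊢ Y ⇒ □ (h x ⇒ G)) → ⊢ Y ⇒ □ (⋁ xs h ⇒ G)
  □⋁-rule [] {h} p = weaken (nec□ (⋁-rule [] {h} λ _ ()))
  □⋁-rule (x ∷ xs) p = □-map₂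
    (prop (⇒i λ a → ⇒i λ b → ⇒i λ q → [ ⇒e a , ⇒e b ]′ (∨e q)))
    (p x (here refl)) (□⋁-rule xs λ y i → p y (there i))

  occurs-⋁ : ∀ {p} xs {h} → p occursIn ⋁ xs h → ∃ λ x → x ∈ xs × p occursIn h x
  occurs-⋁ (x ∷ xs) (in∨ˡ o) = x , here refl , o
  occurs-⋁ (x ∷ xs) (in∨ʳ o) = let y , i , r = occurs-⋁ xs o in y , there i , r

  occurs-⋀ : ∀ {p} xs {h} → p occursIn ⋀ xs h → ∃ λ x → x ∈ xs × p occursIn h x
  occurs-⋀ xs (in¬ o) with occurs-⋁ xs o
  ... | x , i , in¬ r = x , i , r

infixr 7 _∧'_
_∧'_ : Form → Form → Form
A ∧' B = ¬' ((¬' A) ∨' (¬' B))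

∧i : ∀ {f A B} → f ⊨ A → f ⊨ B → f ⊨ A ∧' B
∧i a b = ¬i λ q → [ (λ n → ¬e n a) , (λ n → ¬e n b) ]′ (∨e q)

∧e₁ : ∀ {f A B} → f ⊨ A ∧' B → f ⊨ A
∧e₁ p = by-contra λ n → ¬e p (∨l n)

∧e₂ : ∀ {f A B} → f ⊨ A ∧' B → f ⊨ B
∧e₂ p = by-contra λ n → ¬e p (∨r n)

⊢∧ : ∀ {X A B} → ⊢ X ⇒ A → ⊢ X ⇒ B → ⊢ X ⇒ A ∧' B
⊢∧ p q = prop₂ p q λ a b → ⇒i λ x → ∧i (⇒e a x) (⇒e b x)

occurs-∧ : ∀ {p A B} → p occursIn (A ∧' B) → p occursIn A ⊎ p occursIn B
occurs-∧ (in¬ (in∨ˡ (in¬ o))) = inj₁ o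
occurs-∧ (in¬ (in∨ʳ (in¬ o))) = inj₂ o

-- Selects disjuncts by a decidable condition while the index list stays fixed; a satisfied disjunct
-- gives its condition back.
guard : {P : Set} → Dec P → Form → Form
guard (yes _) A = A
guard (no _) A = ⊥'

module _ {P : Set} where

  guard-intro : ∀ {f A} (d : Dec P) → P → f ⊨ A → f ⊨ guard d A
  guard-intro (yes _) _ a = a
  guard-intro (no n) p _ = ⊥-elim (n p)

  guard-elim : ∀ {f A} (d : Dec P) → f ⊨ guard d A → P × f ⊨ A
  guard-elim (yes p) a = p , a
  guard-elim (no _) a = ⊥-elim (¬⊥ a)

  guard-rule : ∀ {A G} (d : Dec P) → (P → ⊢ A ⇒ G) → ⊢ guard d A ⇒ G
  guard-rule (yes p) h = h p
  guard-rule (no _) _ = prop (⇒i λ q → ⊥-elim (¬⊥ q))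

  occurs-guard : ∀ {p A} (d : Dec P) → p occursIn guard d A → P × p occursIn A
  occurs-guard (yes q) o = q , o

-- Types over a list of atoms

lit : Bool → Form → Form
lit true F = F
lit false F = ¬' F

lit-intro : ∀ {f} b F → ⟦ f ⟧ F ≡ b → f ⊨ lit b F
lit-intro true F e = ⟨ e ⟩
lit-intro false F e = ⟨ cong not e ⟩

lit-elim : ∀ {f} b F → f ⊨ lit b F → ⟦ f ⟧ F ≡ b
lit-elim true F ⟨ e ⟩ = e
lit-elim {f} false F h with bool (⟦ f ⟧ F)
... | inj₁ e = ⊥-elim (¬e h ⟨ e ⟩)
... | inj₂ e = e

occurs-lit : ∀ {p} b {F} → p occursIn lit b F → p occursIn F
occurs-lit true o = o
occurs-lit false (in¬ o) = o

dsc : List Form → Val → Form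
dsc L t = ⋀ L λ F → lit (t F) F

update : Form → Bool → Val → Val
update F b t G with G ≟F F
... | yes _ = b
... | no _ = t G

types : List Form → List Val
-- The default `true` outside the list matters later: it makes `⊓` extend both of its arguments, and
-- it makes `■ D` true for theorems `D` whose `■ D` is not listed.
types [] = (λ _ → true) ∷ []
types (F ∷ L) = map (update F true) (types L) ++ map (update F false) (types L)

update∈types : ∀ {F} L {t} b → t ∈ types L → update F b t ∈ types (F ∷ L)
update∈types L true i = ∈-++⁺ˡ (∈-map⁺ _ i)
update∈types {F} L false i = ∈-++⁺ʳ (map (update F true) (types L)) (∈-map⁺ _ i)

types-complete : ∀ f L → ∃ λ t → t ∈ types L × (∀ G → G ∈ L → ⟦ f ⟧ G ≡ t G)
types-complete f [] = _ , here refl , λ _ ()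
types-complete f (F ∷ L) with types-complete f L
... | t , i , h = update F (⟦ f ⟧ F) t , update∈types L (⟦ f ⟧ F) i , go
  where
  go : ∀ G → G ∈ F ∷ L → ⟦ f ⟧ G ≡ update F (⟦ f ⟧ F) t G
  go G j with G ≟F F
  go G j | yes refl = refl
  go G (here e) | no n = ⊥-elim (n e)
  go G (there j) | no _ = h G j

update-≢ : ∀ {F} b t {G} → ¬ (G ≡ F) → update F b t G ≡ t G
update-≢ {F} b t {G} n with G ≟F F
... | yes e = ⊥-elim (n e)
... | no _ = refl

types-default : ∀ L {t G} → t ∈ types L → G ∉ L → t G ≡ true
types-default [] (here refl) n = refl
types-default (F ∷ L) {t} {G} i n with ∈-++⁻ (map (update F true) (types L)) i
... | inj₁ j with ∈-map⁻ _ j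
...   | s , k , refl = trans (update-≢ true s (n ∘ here)) (types-default L k (n ∘ there))
types-default (F ∷ L) {t} {G} i n | inj₂ j with ∈-map⁻ _ j
...   | s , k , refl = trans (update-≢ false s (n ∘ here)) (types-default L k (n ∘ there))

dsc-elim : ∀ {L t f G} → f ⊨ dsc L t → G ∈ L → ⟦ f ⟧ G ≡ t G
dsc-elim {t = t} {G = G} h i = lit-elim (t G) G (⋀-elim h i)

⊢⋁dsc : ∀ L → ⊢ ⋁ (types L) (dsc L)
⊢⋁dsc L = prop λ {f} → let t , i , h = types-complete f L in
  ⋁-intro i (⋀-intro λ G j → lit-intro (t G) G (h G j))

cover : ∀ L {G} → (∀ t → t ∈ types L → ⊢ dsc L t ⇒ G) → ⊢ G
cover L h = mp (⋁-rule (types L) h) (⊢⋁dsc L)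

□-cover : ∀ L {X G} → (∀ t → t ∈ types L → ⊢ X ⇒ □ (dsc L t ⇒ G)) → ⊢ X ⇒ □ G
□-cover L h = □-map₂ (prop (⇒i λ a → ⇒i λ b → ⇒e a b))
  (□⋁-rule (types L) h) (weaken (nec□ (⊢⋁dsc L)))

-- Coverage, agreement and closed lists of atoms.

Cov : List Form → Form → Set
Cov L (var p) = var p ∈ L
Cov L ⊥' = ⊤
Cov L (¬' A) = Cov L A
Cov L (A ∨' B) = Cov L A × Cov L B
Cov L (□ A) = □ A ∈ L × Cov L A
Cov L (■ A) = ■ A ∈ L × Cov L A

data Atom : Form → Set where
  at-var : ∀ p → Atom (var p)
  at-□ : ∀ A → Atom (□ A)
  at-■ : ∀ A → Atom (■ A)

-- Restricted to atoms because the raw value of a valuation at other formulas is arbitrary: `⟦ f ⟧`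
-- consults `f` only at variables and modal formulas.
Agree : List Form → Val → Val → Set
Agree L f t = ∀ {G} → Atom G → G ∈ L → f G ≡ t G

agree-dsc : ∀ {L t f} → f ⊨ dsc L t → Agree L f t
agree-dsc h (at-var p) i = dsc-elim h i
agree-dsc h (at-□ A) i = dsc-elim h i
agree-dsc h (at-■ A) i = dsc-elim h i

cov-agree : ∀ {L f t} → Agree L f t → ∀ F → Cov L F → ⟦ f ⟧ F ≡ ⟦ t ⟧ F
cov-agree a (var p) c = a (at-var p) c
cov-agree a ⊥' c = refl
cov-agree a (¬' A) c = cong not (cov-agree a A c)
cov-agree a (A ∨' B) (c , d) = cong₂ _∨_ (cov-agree a A c) (cov-agree a B d)
cov-agree a (□ A) (c , _) = a (at-□ A) c
cov-agree a (■ A) (c , _) = a (at-■ A) c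

dsc-decides : ∀ {L t F} b → Cov L F → ⟦ t ⟧ F ≡ b → ⊢ dsc L t ⇒ lit b F
dsc-decides {F = F} b c e = prop (⇒i λ h → lit-intro b F (trans (cov-agree (agree-dsc h) F c) e))

dsc-lit : ∀ {L t G} b → G ∈ L → t G ≡ b → ⊢ dsc L t ⇒ lit b G
dsc-lit {G = G} b i e = prop (⇒i λ h → lit-intro b G (trans (dsc-elim h i) e))

cov-mono : ∀ {L M} → (∀ {G} → G ∈ L → G ∈ M) → ∀ F → Cov L F → Cov M F
cov-mono s (var p) c = s c
cov-mono s ⊥' c = tt
cov-mono s (¬' A) c = cov-mono s A c
cov-mono s (A ∨' B) (c , d) = cov-mono s A c , cov-mono s B d
cov-mono s (□ A) (c , d) = s c , cov-mono s A d
cov-mono s (■ A) (c , d) = s c , cov-mono s A d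

-- For ■D the boxes □D and □¬D are tracked too, as they constrain ■D at endpoints.
atoms : Form → List Form
atoms (var p) = var p ∷ []
atoms ⊥' = []
atoms (¬' A) = atoms A
atoms (A ∨' B) = atoms A ++ atoms B
atoms (□ A) = □ A ∷ atoms A
atoms (■ A) = ■ A ∷ □ A ∷ □ (¬' A) ∷ atoms A

-- The value of `□ ⊥'` is what tells endpoints from inner nodes, so it is always tracked.
closure : Form → List Form
closure A = □ ⊥' ∷ atoms A

record Closed (L : List Form) : Set where
  field
    □⊥∈ : □ ⊥' ∈ L
    □-cov : ∀ {E} → □ E ∈ L → Cov L E
    ■-□ : ∀ {D} → ■ D ∈ L → □ D ∈ L
    ■-□¬ : ∀ {D} → ■ D ∈ L → □ (¬' D) ∈ L

atoms-cov : ∀ {L} A → (∀ {G} → G ∈ atoms A → G ∈ L) → Cov L A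
atoms-cov (var p) s = s (here refl)
atoms-cov ⊥' s = tt
atoms-cov (¬' A) s = atoms-cov A s
atoms-cov (A ∨' B) s = atoms-cov A (s ∘ ∈-++⁺ˡ) , atoms-cov B (s ∘ ∈-++⁺ʳ (atoms A))
atoms-cov (□ A) s = s (here refl) , atoms-cov A (s ∘ there)
atoms-cov (■ A) s = s (here refl) , atoms-cov A (s ∘ there ∘ there ∘ there)

closure-cov : ∀ A → Cov (closure A) A
closure-cov A = atoms-cov A there

atoms-□ : ∀ A {E} → □ E ∈ atoms A → ∀ {G} → G ∈ atoms E → G ∈ atoms A
atoms-□ (var p) (here ())
atoms-□ (¬' A) i j = atoms-□ A i j
atoms-□ (A ∨' B) i j with ∈-++⁻ (atoms A) i
... | inj₁ k = ∈-++⁺ˡ (atoms-□ A k j)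
... | inj₂ k = ∈-++⁺ʳ (atoms A) (atoms-□ B k j)
atoms-□ (□ A) (here refl) j = there j
atoms-□ (□ A) (there i) j = there (atoms-□ A i j)
atoms-□ (■ A) (there (here refl)) j = there (there (there j))
atoms-□ (■ A) (there (there (here refl))) j = there (there (there j))
atoms-□ (■ A) (there (there (there i))) j = there (there (there (atoms-□ A i j)))

atoms-■ : ∀ A {D} → ■ D ∈ atoms A → □ D ∈ atoms A × □ (¬' D) ∈ atoms A
atoms-■ (var p) (here ())
atoms-■ (¬' A) i = atoms-■ A i
atoms-■ (A ∨' B) i with ∈-++⁻ (atoms A) i
... | inj₁ k = let a , b = atoms-■ A k in ∈-++⁺ˡ a , ∈-++⁺ˡ b
... | inj₂ k = let a , b = atoms-■ B k in ∈-++⁺ʳ (atoms A) a , ∈-++⁺ʳ (atoms A) b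
atoms-■ (□ A) (there i) = let a , b = atoms-■ A i in there a , there b
atoms-■ (■ A) (here refl) = there (here refl) , there (there (here refl))
atoms-■ (■ A) (there (there (there i))) =
  let a , b = atoms-■ A i in there (there (there a)) , there (there (there b))

closure-closed : ∀ A → Closed (closure A)
closure-closed A = record
  { □⊥∈ = here refl
  ; □-cov = λ { (here refl) → tt ; {E} (there i) → atoms-cov E (there ∘ atoms-□ A i) }
  ; ■-□ = λ { (there i) → there (proj₁ (atoms-■ A i)) }
  ; ■-□¬ = λ { (there i) → there (proj₂ (atoms-■ A i)) }
  }

occurs-atoms : ∀ A {F p} → F ∈ atoms A → p occursIn F → p occursIn A
occurs-atoms (var p) (here refl) o = o
occurs-atoms (¬' A) i o = in¬ (occurs-atoms A i o)
occurs-atoms (A ∨' B) i o with ∈-++⁻ (atoms A) i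
... | inj₁ k = in∨ˡ (occurs-atoms A k o)
... | inj₂ k = in∨ʳ (occurs-atoms B k o)
occurs-atoms (□ A) (here refl) o = o
occurs-atoms (□ A) (there i) o = in□ (occurs-atoms A i o)
occurs-atoms (■ A) (here refl) o = o
occurs-atoms (■ A) (there (here refl)) (in□ o) = in■ o
occurs-atoms (■ A) (there (there (here refl))) (in□ (in¬ o)) = in■ o
occurs-atoms (■ A) (there (there (there i))) o = in■ (occurs-atoms A i o)

occurs-closure : ∀ A {F p} → F ∈ closure A → p occursIn F → p occursIn A
occurs-closure A (here refl) (in□ ())
occurs-closure A (there i) o = occurs-atoms A i o

-- Tree models

data Tree : Set where
  node : Val → List Tree → Tree

children : Tree → List Tree
children (node _ cs) = cs

vars : Tree → ℕ → Bool
vars (node f _) p = f (var p)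

same : Bool → Bool → Bool
same true b = b
same false b = not b

-- The first argument is the parent, if any. At an inner node ■ is □; at a leaf ■D
-- is forced by the parent satisfying □D or □¬D, and is otherwise read off the valuation.
ev : Maybe Tree → Tree → Form → Bool
black : Maybe Tree → Tree → Form → Bool
leaf■ : Maybe Tree → Val → Form → Bool
-- The Boolean carries the sign: `everywhere false w A` has the value of `□ (¬' A)` at `w`.
-- Recursion on `A` stays structural this way, whereas `¬' A` is no smaller than the `■ A` being
-- evaluated.
everywhere : Bool → Tree → Form → Bool
everywheres : Bool → Tree → List Tree → Form → Bool

ev m t (var p) = vars t p
ev m t ⊥' = false
ev m t (¬' A) = not (ev m t A)
ev m t (A ∨' B) = ev m t A ∨ ev m t B
ev m t (□ A) = everywhere true t A
ev m t (■ A) = black m t A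

black m (node f []) A = leaf■ m f A
black m (node f (c ∷ cs)) A = everywhere true (node f (c ∷ cs)) A

leaf■ nothing f A = f (■ A)
leaf■ (just w) f A = everywhere true w A ∨ (not (everywhere false w A) ∧ f (■ A))

everywhere b (node f cs) A = everywheres b (node f cs) cs A

everywheres b w [] A = true
everywheres b w (c ∷ cs) A = (same b (ev (just w) c A) ∧ everywhere b c A) ∧ everywheres b w cs A

-- In Desc w p d the node p is the parent of d.
data Desc : Tree → Tree → Tree → Set where
  child : ∀ {w c} → c ∈ children w → Desc w w c
  deeper : ∀ {w c p d} → c ∈ children w → Desc c p d → Desc w p d

desc-∈ : ∀ {w p d} → Desc w p d → d ∈ children p
desc-∈ (child i) = i
desc-∈ (deeper _ x) = desc-∈ x

desc-trans : ∀ {w p d q e} → Desc w p d → Desc d q e → Desc w q e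
desc-trans (child i) y = deeper i y
desc-trans (deeper i x) y = deeper i (desc-trans x y)

-- Covers the case where `p` is `w` itself. It serves leaves `d`, whose `■` depends on all
-- descendants of the parent `p`.
desc-parent : ∀ {w p d q e} → Desc w p d → Desc p q e → Desc w q e
desc-parent (child i) y = y
desc-parent (deeper i x) y = deeper i (desc-parent x y)

same-elim : ∀ b {x} → same b x ≡ true → x ≡ b
same-elim true e = e
same-elim false {false} e = refl

same-intro : ∀ b {x} → x ≡ b → same b x ≡ true
same-intro true refl = refl
same-intro false refl = refl

∧-elim : ∀ {x y} → x ∧ y ≡ true → x ≡ true × y ≡ true
∧-elim {true} {true} refl = refl , refl

∧-intro : ∀ {x y} → x ≡ true → y ≡ true → x ∧ y ≡ true
∧-intro refl refl = refl

everywhere-elim : ∀ b w A {p d} → everywhere b w A ≡ true → Desc w p d → ev (just p) d A ≡ b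
everywheres-elim : ∀ b w cs A {c} → everywheres b w cs A ≡ true → c ∈ cs →
  ev (just w) c A ≡ b × (∀ {p d} → Desc c p d → ev (just p) d A ≡ b)

everywhere-elim b (node f cs) A e (child i) = proj₁ (everywheres-elim b _ cs A e i)
everywhere-elim b (node f cs) A e (deeper i x) = proj₂ (everywheres-elim b _ cs A e i) x

everywheres-elim b w (c ∷ cs) A e (here refl) =
  let h , _ = ∧-elim e ; x , y = ∧-elim h in same-elim b x , everywhere-elim b c A y
everywheres-elim b w (c ∷ cs) A e (there i) = everywheres-elim b w cs A (proj₂ (∧-elim e)) i

everywhere-intro : ∀ b w A → (∀ {p d} → Desc w p d → ev (just p) d A ≡ b) → everywhere b w A ≡ true
everywheres-intro : ∀ b w cs A → (∀ {c} → c ∈ cs → c ∈ children w) →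
  (∀ {p d} → Desc w p d → ev (just p) d A ≡ b) → everywheres b w cs A ≡ true

everywhere-intro b (node f cs) A h = everywheres-intro b _ cs A id h

everywheres-intro b w [] A s h = refl
everywheres-intro b w (c ∷ cs) A s h = ∧-intro
  (∧-intro (same-intro b (h (child (s (here refl)))))
           (everywhere-intro b c A (h ∘ deeper (s (here refl)))))
  (everywheres-intro b w cs A (s ∘ there) h)

-- Structural induction on the finite tree: `A` is established on all descendants of a child before
-- `h` is applied to that child.
löb : ∀ A t → (∀ {p d} → Desc t p d → everywhere true d A ≡ true → ev (just p) d A ≡ true) →
  ∀ {p d} → Desc t p d → ev (just p) d A ≡ true
löbs : ∀ A cs → (∀ {c} → c ∈ cs → ∀ {p d} → Desc c p d → everywhere true d A ≡ true → ev (just p) d A ≡ true) →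
  ∀ {c} → c ∈ cs → ∀ {p d} → Desc c p d → ev (just p) d A ≡ true
löb A (node f cs) h (child i) = h (child i) (everywhere-intro true _ A (löbs A cs (λ j → h ∘ deeper j) i))
löb A (node f cs) h (deeper i x) = löbs A cs (λ j → h ∘ deeper j) i x
löbs A (c ∷ cs) h (here refl) = löb A c (h (here refl))
löbs A (c ∷ cs) h (there i) = löbs A cs (h ∘ there) i

-- Soundness of the logic for tree models.

-- A leaf that is the root has no parent to force `■ D`, so `nec■` must be imposed on its valuation.
-- At an inner root `■` is `□`, and `nec■` holds by itself.
RootOK : Tree → Set
RootOK (node f []) = ∀ D → ⊢ D → f (■ D) ≡ true
RootOK (node f (_ ∷ _)) = ⊤

Valid : Maybe Tree → Tree → Set
Valid nothing t = RootOK t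
Valid (just p) t = t ∈ children p

ev-eval : ∀ m t A → ev m t A ≡ eval (vars t) (ev m t) A
ev-eval m t (var p) = refl
ev-eval m t ⊥' = refl
ev-eval m t (¬' A) = cong not (ev-eval m t A)
ev-eval m t (A ∨' B) = cong₂ _∨_ (ev-eval m t A) (ev-eval m t B)
ev-eval m t (□ A) = refl
ev-eval m t (■ A) = refl

imp : ∀ {x y} → (x ≡ true → y ≡ true) → not x ∨ y ≡ true
imp {false} h = refl
imp {true} h = h refl

unimp : ∀ {x y} → not x ∨ y ≡ true → x ≡ true → y ≡ true
unimp {true} h _ = h

not-intro : ∀ {x} → ¬ (x ≡ true) → x ≡ false
not-intro {false} h = refl
not-intro {true} h = ⊥-elim (h refl)

not-elim : ∀ {x} → not x ≡ true → x ≡ false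
not-elim {false} _ = refl

∨-introʳ : ∀ {x y} → y ≡ true → x ∨ y ≡ true
∨-introʳ {x} refl = Boolₚ.∨-zeroʳ x

leaf■-true : ∀ w f A → everywhere true w A ≡ true → leaf■ (just w) f A ≡ true
leaf■-true w f A e rewrite e = refl

leaf■-false : ∀ w f A → everywhere true w A ≡ false → everywhere false w A ≡ true →
  leaf■ (just w) f A ≡ false
leaf■-false w f A e e' rewrite e | e' = refl

-- If `d` is a leaf, `A` also holds at all descendants of its parent, which forces `■ A`; if `d` is
-- inner, transitivity suffices.
□⇒□■ : ∀ {t p d} A → everywhere true t A ≡ true → Desc t p d → ev (just p) d (■ A) ≡ true
□⇒□■ {t} {p} {node f []} A e x = leaf■-true p f A
  (everywhere-intro true p A (everywhere-elim true t A e ∘ desc-parent x))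
□⇒□■ {t} {p} {node f (c ∷ cs)} A e x =
  everywhere-intro true (node f (c ∷ cs)) A (everywhere-elim true t A e ∘ desc-trans x)

-- At a leaf the two forcing clauses cannot clash, because `d` itself refutes `A` above its parent.
-- At an inner node any child refutes `A`, hence `□ A`.
□¬⇒□¬■ : ∀ {t p d} A → (∀ {p d} → Desc t p d → ev (just p) d A ≡ false) → Desc t p d →
  ev (just p) d (■ A) ≡ false
□¬⇒□¬■ {t} {p} {node f []} A h x = leaf■-false p f A
  (not-intro λ e → true≢false (everywhere-elim true p A e (child (desc-∈ x))) (h x))
  (everywhere-intro false p A (h ∘ desc-parent x))
□¬⇒□¬■ {t} {p} {node f (c ∷ cs)} A h x =
  not-intro λ e → let y = child (here refl) in
    true≢false (everywhere-elim true (node f (c ∷ cs)) A e y) (h (desc-trans x y))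

-- `ax■□` and `ax□⊥` hold at leaves because every `□` is true there, and at inner nodes because `■`
-- is `□`.
sound : ∀ {A} → ⊢ A → ∀ m t → Valid m t → ev m t A ≡ true
sound {A} (taut h) m t v = trans (ev-eval m t A) (h (vars t) (ev m t))
sound (axK {A} {B}) m t v = imp λ e → imp λ e' → everywhere-intro true t B λ x →
  unimp (everywhere-elim true t (A ⇒ B) e x) (everywhere-elim true t A e' x)
sound (axL {A}) m t v = imp λ e → everywhere-intro true t A
  (löb A t (unimp ∘ everywhere-elim true t (□ A ⇒ A) e))
sound (ax■□ {A}) m (node f []) v = Boolₚ.∨-zeroʳ _
sound (ax■□ {A}) m (node f (c ∷ cs)) v = imp {everywhere true (node f (c ∷ cs)) A} id
sound (ax□□■ {A}) m t v = imp λ e → everywhere-intro true t (■ A) (□⇒□■ A e)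
sound (ax□⊥ {A}) m (node f []) v = refl
sound (ax□⊥ {A}) m (node f (c ∷ cs)) v =
  imp {everywhere true (node f (c ∷ cs)) A} (∨-introʳ {everywhere true (node f (c ∷ cs)) ⊥'})
sound (ax◇■ {A}) m t v = imp λ e → cong not (not-intro λ e' → true≢false
  (everywhere-intro true t (¬' ■ A) λ x → cong not (□¬⇒□¬■ A (not-elim ∘ everywhere-elim true t (¬' A) e') x))
  (not-elim e))
sound (mp p q) m t v = unimp (sound p m t v) (sound q m t v)
sound (nec□ {A} p) m t v = everywhere-intro true t A λ {q} {d} x → sound p (just q) d (desc-∈ x)
-- The only place where validity of the root matters: `v` is exactly `RootOK` for a one-point tree.
sound (nec■ {A} p) nothing (node f []) v = v A p
sound (nec■ {A} p) (just w) (node f []) v = leaf■-true w f A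
  (everywhere-intro true w A λ {q} {d} x → sound p (just q) d (desc-∈ x))
sound (nec■ {A} p) m (node f (c ∷ cs)) v =
  everywhere-intro true (node f (c ∷ cs)) A λ {q} {d} x → sound p (just q) d (desc-∈ x)

-- Legitimate types, their successors, and trees built from them

-- The conditions on a single point: `inner■` is forced by `ax■□` and `ax□⊥`, `leaf-thm` by `nec■`.
record Legit (L : List Form) (s : Val) : Set where
  constructor mkLegit
  field
    inner■ : s (□ ⊥') ≡ false → ∀ D → ■ D ∈ L → s (■ D) ≡ s (□ D)
    leaf-thm : s (□ ⊥') ≡ true → ∀ D → ■ D ∈ L → ⊢ D → s (■ D) ≡ true

-- `step□` reflects transitivity; `leaf■-forced` reflects `ax□□■` and `ax◇■`. A type may be its own
-- successor: strict descent comes only from successors at which a formerly false box is true.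
record Succ (L : List Form) (t s : Val) : Set where
  constructor mkSucc
  field
    legit : Legit L s
    step□ : ∀ E → □ E ∈ L → t (□ E) ≡ true → s (□ E) ≡ true × ⟦ s ⟧ E ≡ true
    leaf■-forced : s (□ ⊥') ≡ true → ∀ D → ■ D ∈ L →
      (t (□ D) ≡ true → s (■ D) ≡ true) × (t (□ (¬' D)) ≡ true → s (■ D) ≡ false)

open Legit
open Succ

Realized : List Form → Val → Set
Realized L s = Σ Tree λ M → (∀ F → Cov L F → ev nothing M F ≡ ⟦ s ⟧ F) × RootOK M

module Bodies (c : Form → Form) (c-injective : ∀ {A B} → c A ≡ c B → A ≡ B)
  (shape? : ∀ F → Dec (∃ λ D → F ≡ c D)) where

  bodies : List Form → List Form
  bodies [] = []
  bodies (F ∷ L) with shape? F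
  ... | yes (D , _) = D ∷ bodies L
  ... | no _ = bodies L

  ∈-bodies⁺ : ∀ {L E} → c E ∈ L → E ∈ bodies L
  ∈-bodies⁺ {F ∷ L} i with shape? F
  ∈-bodies⁺ {F ∷ L} (here e) | yes (D , e') = here (c-injective (trans e e'))
  ∈-bodies⁺ {F ∷ L} (there i) | yes _ = there (∈-bodies⁺ i)
  ∈-bodies⁺ {F ∷ L} (here refl) | no n = ⊥-elim (n (_ , refl))
  ∈-bodies⁺ {F ∷ L} (there i) | no _ = ∈-bodies⁺ i

  ∈-bodies⁻ : ∀ L {E} → E ∈ bodies L → c E ∈ L
  ∈-bodies⁻ (F ∷ L) i with shape? F
  ∈-bodies⁻ (F ∷ L) (here refl) | yes (D , refl) = here refl
  ∈-bodies⁻ (F ∷ L) (there i) | yes _ = there (∈-bodies⁻ L i)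
  ∈-bodies⁻ (F ∷ L) i | no _ = there (∈-bodies⁻ L i)

is□? : ∀ F → Dec (∃ λ D → F ≡ □ D)
is□? (var _) = no λ ()
is□? ⊥' = no λ ()
is□? (¬' _) = no λ ()
is□? (_ ∨' _) = no λ ()
is□? (□ D) = yes (D , refl)
is□? (■ _) = no λ ()

is■? : ∀ F → Dec (∃ λ D → F ≡ ■ D)
is■? (var _) = no λ ()
is■? ⊥' = no λ ()
is■? (¬' _) = no λ ()
is■? (_ ∨' _) = no λ ()
is■? (□ _) = no λ ()
is■? (■ D) = yes (D , refl)

□-injective : ∀ {A B} → □ A ≡ □ B → A ≡ B
□-injective refl = refl

■-injective : ∀ {A B} → ■ A ≡ ■ B → A ≡ B
■-injective refl = refl

module □B = Bodies □_ □-injective is□?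
module ■B = Bodies ■_ ■-injective is■?

-- Glues realisations of successor types below a new root, one for each false box. `thms` ranges
-- over all theorems, not just those with `■ D` in `L`, because `RootOK` does.
module Build {L : List Form} (cl : Closed L) {s : Val} (lg : Legit L s)
  (thms : s (□ ⊥') ≡ true → ∀ D → ⊢ D → s (■ D) ≡ true)
  (witness : ∀ E → □ E ∈ L → s (□ E) ≡ false →
    Σ Val λ r → Succ L s r × ⟦ r ⟧ E ≡ false × Realized L r)
  where

  open Closed cl

  Child : Tree → Set
  Child c = Σ Val λ r → Succ L s r × (∀ F → Cov L F → ev nothing c F ≡ ⟦ r ⟧ F)

  Refutes : List Tree → Form → Set
  Refutes cs E = Σ Tree λ c → c ∈ cs × Σ (Child c) λ k → ⟦ proj₁ k ⟧ E ≡ false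

  collect : ∀ bs → (∀ {E} → E ∈ bs → □ E ∈ L) → Σ (List Tree) λ cs →
    (∀ {c} → c ∈ cs → Child c) × (∀ {E} → E ∈ bs → s (□ E) ≡ false → Refutes cs E)
  collect [] h = [] , (λ ()) , λ ()
  collect (E ∷ bs) h with collect bs (h ∘ there) | bool (s (□ E))
  ... | cs , ch , ref | inj₁ e =
    cs , ch , λ { (here refl) e' → ⊥-elim (true≢false e e') ; (there i) e' → ref i e' }
  ... | cs , ch , ref | inj₂ e with witness E (h (here refl)) e
  ...   | r , g , n , M , real , _ =
    M ∷ cs , (λ { (here refl) → r , g , real ; (there i) → ch i }) ,
    λ { (here refl) _ → M , here refl , (r , g , real) , n
      ; (there i) e' → let c , j , x = ref i e' in c , there j , x }

  module _ (cs : List Tree) (ch : ∀ {c} → c ∈ cs → Child c)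
    (ref : ∀ {E} → □ E ∈ L → s (□ E) ≡ false → Refutes cs E) where

    w : Tree
    w = node s cs

    -- Attaching a tree below `w` can change values at its root only if that root is a leaf, since
    -- `■` now depends on `w`. In that case `leaf■-forced` shows that the value prescribed by the
    -- type is still the right one.
    truth : ∀ F → Cov L F → ∀ {c} → c ∈ cs → (k : Child c) → ev (just w) c F ≡ ⟦ proj₁ k ⟧ F

    -- By contraposition: if `s (□ F)` is false, some child refutes `F` and so gives `E` the value
    -- `not b`. Here `F` is `E` for `b` true and `¬' E` for `b` false.
    □-false : ∀ b E F → □ F ∈ L → Cov L E → (∀ r → ⟦ r ⟧ F ≡ false → ⟦ r ⟧ E ≡ not b) →
      everywhere b w E ≡ true → s (□ F) ≡ true
    □-false b E F i cov neg e with bool (s (□ F))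
    ... | inj₁ e' = e'
    ... | inj₂ e' = let c , j , k , n = ref i e' in
      ⊥-elim (Boolₚ.not-¬ {b} refl (trans (sym (everywhere-elim b w E e (child j)))
        (trans (truth E cov j k) (neg (proj₁ k) n))))

    truth (var p) cov i (r , g , real) = real (var p) cov
    truth ⊥' cov i k = refl
    truth (¬' A) cov i k = cong not (truth A cov i k)
    truth (A ∨' B) (c , d) i k = cong₂ _∨_ (truth A c i k) (truth B d i k)
    truth (□ A) cov i (r , g , real) = real (□ A) cov
    truth (■ A) cov {node f (_ ∷ _)} i (r , g , real) = real (■ A) cov
    truth (■ A) cov@(j , c) {node f []} i (r , g , real)
      with leaf■-forced g (sym (real (□ ⊥') (□⊥∈ , tt))) A j
    ... | g⁺ , g⁻ with bool (everywhere true w A) | bool (everywhere false w A)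
    ... | inj₁ e | _ = trans (leaf■-true w f A e)
      (sym (g⁺ (□-false true A A (■-□ j) c (λ _ → id) e)))
    ... | inj₂ e | inj₁ e' = trans (leaf■-false w f A e e')
      (sym (g⁻ (□-false false A (¬' A) (■-□¬ j) c (λ _ → Boolₚ.not-injective) e')))
    ... | inj₂ e | inj₂ e' = trans (cong₂ (λ x y → x ∨ (not y ∧ f (■ A))) e e') (real (■ A) cov)

    □-truth : ∀ E → □ E ∈ L → everywhere true w E ≡ s (□ E)
    □-truth E i with bool (s (□ E))
    ... | inj₂ e = trans (not-intro λ e' → true≢false (□-false true E E i (□-cov i) (λ _ → id) e') e) (sym e)
    ... | inj₁ e = trans (everywhere-intro true w E go) (sym e)
      where
      go : ∀ {p d} → Desc w p d → ev (just p) d E ≡ true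
      go (child j) with ch j
      ... | k@(r , g , _) = trans (truth E (□-cov i) j k) (proj₂ (step□ g E i e))
      go (deeper {c = c} j x) with ch j
      ... | r , g , real =
        everywhere-elim true c E (trans (real (□ E) (i , □-cov i)) (proj₁ (step□ g E i e))) x

  root-truth : ∀ cs (ch : ∀ {c} → c ∈ cs → Child c)
    (ref : ∀ {E} → □ E ∈ L → s (□ E) ≡ false → Refutes cs E) →
    ∀ F → Cov L F → ev nothing (node s cs) F ≡ ⟦ s ⟧ F
  root-truth cs ch ref (var p) cov = refl
  root-truth cs ch ref ⊥' cov = refl
  root-truth cs ch ref (¬' A) cov = cong not (root-truth cs ch ref A cov)
  root-truth cs ch ref (A ∨' B) (c , d) = cong₂ _∨_ (root-truth cs ch ref A c) (root-truth cs ch ref B d)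
  root-truth cs ch ref (□ A) (i , _) = □-truth cs ch ref A i
  root-truth [] ch ref (■ A) cov = refl
  root-truth (c ∷ cs) ch ref (■ A) (i , _) with bool (s (□ ⊥'))
  ... | inj₂ e = trans (□-truth (c ∷ cs) ch ref A (■-□ i)) (sym (inner■ lg e A i))
  -- An endpoint type has no successor: `step□` would make `⊥'` true at the child.
  ... | inj₁ e with ch (here refl)
  ...   | r , g , _ with step□ g ⊥' □⊥∈ e
  ...     | _ , ()

  root-ok : ∀ cs (ref : ∀ {E} → □ E ∈ L → s (□ E) ≡ false → Refutes cs E) → RootOK (node s cs)
  root-ok (_ ∷ _) ref = tt
  root-ok [] ref with bool (s (□ ⊥'))
  ... | inj₁ e = thms e
  -- With `□ ⊥'` false there would be a child refuting `⊥'`, but the list of children is empty.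
  ... | inj₂ e with ref □⊥∈ e
  ...   | _ , () , _

  build : Realized L s
  build with collect (□B.bodies L) (□B.∈-bodies⁻ L)
  ... | cs , ch , ref = node s cs , root-truth cs ch (ref ∘ □B.∈-bodies⁺) , root-ok cs (ref ∘ □B.∈-bodies⁺)

-- Refutable types and the modal rules they obey

-- A negative answer carries `X`, which below is a derivation excluding the type or pair of types
-- under test.
DecR : Set → Set → Set
DecR A X = A ⊎ (¬ A × X)

toDec : ∀ {A X} → DecR A X → Dec A
toDec (inj₁ a) = yes a
toDec (inj₂ (n , _)) = no n

_×R_ : ∀ {A B X} → DecR A X → DecR B X → DecR (A × B) X
inj₂ (n , x) ×R _ = inj₂ (n ∘ proj₁ , x)
inj₁ _ ×R inj₂ (n , x) = inj₂ (n ∘ proj₂ , x)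
inj₁ a ×R inj₁ b = inj₁ (a , b)

_→R_ : ∀ {P A X : Set} → Dec P → (P → DecR A X) → DecR (P → A) X
no n →R _ = inj₁ λ p → ⊥-elim (n p)
yes p →R h with h p
... | inj₁ a = inj₁ λ _ → a
... | inj₂ (n , x) = inj₂ ((λ g → n (g p)) , x)

≡R : ∀ {X} (a b : Bool) → (a ≡ not b → X) → DecR (a ≡ b) X
≡R true true h = inj₁ refl
≡R false false h = inj₁ refl
≡R true false h = inj₂ ((λ ()) , h refl)
≡R false true h = inj₂ ((λ ()) , h refl)

mapR : ∀ {A X Y} → (X → Y) → DecR A X → DecR A Y
mapR f (inj₁ a) = inj₁ a
mapR f (inj₂ (n , x)) = inj₂ (n , f x)

∀∈? : {I Y : Set} {A : I → Set} (xs : List I) →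
  (∀ x → x ∈ xs → A x ⊎ Y) → (∀ x → x ∈ xs → A x) ⊎ Y
∀∈? [] h = inj₁ λ _ ()
∀∈? (x ∷ xs) h with h x (here refl) | ∀∈? xs (λ y i → h y (there i))
... | inj₂ y | _ = inj₂ y
... | inj₁ a | inj₂ y = inj₂ y
... | inj₁ a | inj₁ as = inj₁ λ { _ (here refl) → a ; y (there i) → as y i }

∀R : ∀ {X} {A : Form → Set} xs → (∀ x → x ∈ xs → DecR (A x) X) → DecR (∀ x → x ∈ xs → A x) X
∀R xs h = ∀∈? xs λ x i → [ inj₁ , (λ { (n , y) → inj₂ ((λ g → n (g x i)) , y) }) ]′ (h x i)

relabel : ∀ {A B X} → (A → B) → (B → A) → DecR A X → DecR B X
relabel f g = [ inj₁ ∘ f , (λ { (n , x) → inj₂ (n ∘ g , x) }) ]′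

∀□R : ∀ {X} {A : Form → Set} L → (∀ E → □ E ∈ L → DecR (A E) X) → DecR (∀ E → □ E ∈ L → A E) X
∀□R L h = relabel (λ g E i → g E (□B.∈-bodies⁺ i)) (λ g E i → g E (□B.∈-bodies⁻ L i))
  (∀R (□B.bodies L) λ E i → h E (□B.∈-bodies⁻ L i))

∀■R : ∀ {X} {A : Form → Set} L → (∀ D → ■ D ∈ L → DecR (A D) X) → DecR (∀ D → ■ D ∈ L → A D) X
∀■R L h = relabel (λ g E i → g E (■B.∈-bodies⁺ i)) (λ g E i → g E (■B.∈-bodies⁻ L i))
  (∀R (■B.bodies L) λ E i → h E (■B.∈-bodies⁻ L i))

refute : ∀ {X A} b → ⊢ X ⇒ lit b A → ⊢ X ⇒ lit (not b) A → ⊢ ¬' X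
refute true p q = prop₂ p q λ a b → ¬i λ x → ¬e (⇒e b x) (⇒e a x)
refute false p q = prop₂ p q λ a b → ¬i λ x → ¬e (⇒e a x) (⇒e b x)

iff-lit : ∀ {X A B} b → ⊢ X ⇒ A ⇒ B → ⊢ X ⇒ B ⇒ A → ⊢ X ⇒ lit b A → ⊢ X ⇒ lit b B
iff-lit true p _ q = prop₂ p q λ a b → ⇒i λ x → ⇒e (⇒e a x) (⇒e b x)
iff-lit false _ p q = prop₂ p q λ a b → ⇒i λ x → ¬i λ y → ¬e (⇒e b x) (⇒e (⇒e a x) y)

-- Stated for an arbitrary formula `nm t` naming the type `t`. Both the descriptions `dsc L` and the
-- interpolants obey the rule, so one construction of joint models serves both.
□-Rule : List Form → (Val → Form) → Val → Set
□-Rule L nm t = ∀ G → (∀ s → s ∈ types L → Succ L t s → ⊢ nm s ⇒ G) → ⊢ nm t ⇒ □ G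

-- A witness refuting `E` may be taken with `□ E` true. This is the force of Löb's axiom, and it
-- makes the rank drop.
◇-Rule : List Form → (Val → Form) → Val → Set
◇-Rule L nm t = ∀ E → □ E ∈ L → t (□ E) ≡ false → ∀ G →
  (∀ r → r ∈ types L → Succ L t r → r (□ E) ≡ true → ⟦ r ⟧ E ≡ false → ⊢ nm r ⇒ G) →
  ⊢ nm t ⇒ ◇ G

module Refutation {L : List Form} (cl : Closed L) (thm? : ∀ D → ■ D ∈ L → Dec (⊢ D)) where

  open Closed cl

  -- At an inner type, `ax■□` and `ax□⊥` make `□ D` and `■ D` equivalent, so differing values are
  -- contradictory; at an endpoint a theorem `D` yields `■ D` by `nec■`.
  legit? : ∀ s → DecR (Legit L s) (⊢ ¬' dsc L s)
  legit? s = relabel (λ (a , b) → mkLegit a b) (λ (mkLegit a b) → a , b) (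
    ((s (□ ⊥') Boolₚ.≟ false) →R λ e → ∀■R L λ D i → ≡R _ _ λ n →
      refute (s (□ D))
        (dsc-lit _ (■-□ i) refl)
        (iff-lit (not (s (□ D))) (weaken ax■□)
          (prop₂ ax□⊥ (dsc-lit false □⊥∈ e) λ a b → ⇒i λ x → ⇒i λ y →
            [ (λ z → ⊥-elim (¬e (⇒e b x) z)) , id ]′ (∨e (⇒e a y)))
          (dsc-lit _ i n)))
    ×R ((s (□ ⊥') Boolₚ.≟ true) →R λ e → ∀■R L λ D i → thm? D i →R λ d → ≡R _ true λ n →
      refute true (weaken (nec■ d)) (dsc-lit false i n)))

  □-refute : ∀ {X A s} b → ⊢ X ⇒ □ (lit b A) → ⊢ dsc L s ⇒ lit (not b) A → ⊢ X ⇒ □ (¬' dsc L s)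
  □-refute true p q = □-map (contrapose q) p
  □-refute false p q = □-map (prop₁ q λ a → ⇒i λ n → ¬i λ x → ¬e n (⇒e a x)) p

  -- Each way of failing to be a successor is excluded by its own principle: legitimacy by
  -- necessitation, persistence of boxes by `□-trans`, truth of bodies by the box itself, and forced
  -- `■` by `ax□□■` and `□¬-■`.
  succ? : ∀ t s → DecR (Succ L t s) (⊢ dsc L t ⇒ □ (¬' dsc L s))
  succ? t s = relabel (λ (a , b , c) → mkSucc a b c) (λ (mkSucc a b c) → a , b , c) (
    mapR (weaken ∘ nec□) (legit? s)
    ×R ((∀□R L λ E i → (t (□ E) Boolₚ.≟ true) →R λ e →
        (≡R _ true λ n → □-refute true (dsc-lit true i e ⟫ □-trans) (dsc-lit false i n))
        ×R (≡R _ true λ n → □-refute true (dsc-lit true i e) (dsc-decides false (□-cov i) n)))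
    ×R ((s (□ ⊥') Boolₚ.≟ true) →R λ _ → ∀■R L λ D i →
        ((t (□ D) Boolₚ.≟ true) →R λ e → ≡R _ true λ n →
          □-refute true (dsc-lit true (■-□ i) e ⟫ ax□□■) (dsc-lit false i n))
        ×R ((t (□ (¬' D)) Boolₚ.≟ true) →R λ e → ≡R _ false λ n →
          □-refute false (dsc-lit true (■-□¬ i) e ⟫ □¬-■) (dsc-lit true i n)))))

  -- The descriptions of all types are exhaustive, also under a box, and those of non-successors are
  -- refuted there by `succ?`.
  dsc-□ : ∀ t → □-Rule L (dsc L) t
  dsc-□ t G h = □-cover L λ s i → go s i (succ? t s)
    where
    go : ∀ s → s ∈ types L → DecR (Succ L t s) (⊢ dsc L t ⇒ □ (¬' dsc L s)) → ⊢ dsc L t ⇒ □ (dsc L s ⇒ G)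
    go s i (inj₁ g) = weaken (nec□ (h s i g))
    go s i (inj₂ (_ , x)) = □-map (prop (⇒i λ n → ⇒i λ y → ⊥-elim (¬e n y))) x

  -- If ◇G failed, the rule for □ would give □(□E ⇒ E), hence □E by Löb.
  dsc-◇ : ∀ t → ◇-Rule L (dsc L) t
  dsc-◇ t E i e G h =
    prop₃ (dsc-□ t ((¬' G) ⇒ □ E ⇒ E) go) axK axL λ a k l → ⇒i λ x → ¬i λ n → bad x n a k l
    where
    bad : ∀ {f} → f ⊨ dsc L t → f ⊨ □ (¬' G) → f ⊨ (dsc L t ⇒ □ ((¬' G) ⇒ □ E ⇒ E)) →
      f ⊨ (□ ((¬' G) ⇒ □ E ⇒ E) ⇒ □ (¬' G) ⇒ □ (□ E ⇒ E)) → f ⊨ (□ (□ E ⇒ E) ⇒ □ E) → ⊥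
    bad x n a k l = true≢false (_⊨_.holds (⇒e l (⇒e (⇒e k (⇒e a x)) n))) (trans (dsc-elim x i) e)
    go : ∀ s → s ∈ types L → Succ L t s → ⊢ dsc L s ⇒ (¬' G) ⇒ □ E ⇒ E
    go s j g with bool (s (□ E)) | bool (⟦ s ⟧ E)
    ... | inj₂ n | _ = prop₁ (dsc-lit false i n) λ a → ⇒i λ x → ⇒i λ _ → ⇒i λ y → ⊥-elim (¬e (⇒e a x) y)
    ... | inj₁ _ | inj₁ y = prop₁ (dsc-decides true (□-cov i) y) λ a → ⇒i λ x → ⇒i λ _ → ⇒i λ _ → ⇒e a x
    ... | inj₁ y | inj₂ n = prop₁ (h s j g y n) λ a → ⇒i λ x → ⇒i λ m → ⊥-elim (¬e m (⇒e a x))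

open DecMembership _≟F_ using (_∈?_)

-- Rank of a type and its descent along successors.

falsity : Bool → ℕ
falsity true = 0
falsity false = 1

rank : List Form → Val → ℕ
rank [] t = 0
rank (E ∷ bs) t = falsity (t (□ E)) + rank bs t

falsity-mono : ∀ {a b} → (a ≡ true → b ≡ true) → falsity b ≤ falsity a
falsity-mono {true} {true} h = z≤n
falsity-mono {true} {false} h with h refl
... | ()
falsity-mono {false} {true} h = z≤n
falsity-mono {false} {false} h = s≤s z≤n

rank-mono : ∀ bs {t s} → (∀ E → E ∈ bs → t (□ E) ≡ true → s (□ E) ≡ true) → rank bs s ≤ rank bs t
rank-mono [] h = z≤n
rank-mono (E ∷ bs) h = ℕₚ.+-mono-≤ (falsity-mono (h E (here refl))) (rank-mono bs λ F i → h F (there i))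

rank-strict : ∀ bs {t s E} → (∀ E → E ∈ bs → t (□ E) ≡ true → s (□ E) ≡ true) →
  E ∈ bs → t (□ E) ≡ false → s (□ E) ≡ true → rank bs s < rank bs t
rank-strict (E ∷ bs) h (here refl) f g rewrite f | g = s≤s (rank-mono bs λ F i → h F (there i))
rank-strict (E ∷ bs) h (there i) f g = ℕₚ.+-mono-≤-<
  (falsity-mono (h E (here refl))) (rank-strict bs (λ F j → h F (there j)) i f g)

rank-bound : ∀ bs t → rank bs t ≤ length bs
rank-bound [] t = z≤n
rank-bound (E ∷ bs) t = ℕₚ.+-mono-≤ (falsity≤1 (t (□ E))) (rank-bound bs t)
  where
  falsity≤1 : ∀ b → falsity b ≤ 1
  falsity≤1 true = z≤n
  falsity≤1 false = s≤s z≤n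

module _ {L : List Form} {t s : Val} (g : Succ L t s) where

  succ-mono : ∀ E → E ∈ □B.bodies L → t (□ E) ≡ true → s (□ E) ≡ true
  succ-mono E i e = proj₁ (step□ g E (□B.∈-bodies⁻ L i) e)

  succ-rank-≤ : rank (□B.bodies L) s ≤ rank (□B.bodies L) t
  succ-rank-≤ = rank-mono _ succ-mono

  succ-rank-< : ∀ {E} → □ E ∈ L → t (□ E) ≡ false → s (□ E) ≡ true →
    rank (□B.bodies L) s < rank (□B.bodies L) t
  succ-rank-< i = rank-strict _ succ-mono (□B.∈-bodies⁺ i)

-- Joint realisation of types over two lists of atoms

closed-++ : ∀ {L M} → Closed L → Closed M → Closed (L ++ M)
closed-++ {L} {M} c d = record
  { □⊥∈ = ∈-++⁺ˡ C.□⊥∈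
  ; □-cov = λ {E} i → [ (λ j → cov-mono ∈-++⁺ˡ E (C.□-cov j)) ,
                      (λ j → cov-mono (∈-++⁺ʳ L) E (D.□-cov j)) ]′ (∈-++⁻ L i)
  ; ■-□ = λ i → [ (λ j → ∈-++⁺ˡ (C.■-□ j)) , (λ j → ∈-++⁺ʳ L (D.■-□ j)) ]′ (∈-++⁻ L i)
  ; ■-□¬ = λ i → [ (λ j → ∈-++⁺ˡ (C.■-□¬ j)) , (λ j → ∈-++⁺ʳ L (D.■-□¬ j)) ]′ (∈-++⁻ L i)
  }
  where
  module C = Closed c
  module D = Closed d

legit-++ : ∀ L {M s} → Legit L s → Legit M s → Legit (L ++ M) s
legit-++ L (mkLegit a c) (mkLegit a' c') = mkLegit
  (λ e D i → [ a e D , a' e D ]′ (∈-++⁻ L i))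
  (λ e D i → [ c e D , c' e D ]′ (∈-++⁻ L i))

succ-++ : ∀ L {M t s} → Succ L t s → Succ M t s → Succ (L ++ M) t s
succ-++ L (mkSucc a b c) (mkSucc a' b' c') = mkSucc
  (legit-++ L a a')
  (λ E i → [ b E , b' E ]′ (∈-++⁻ L i))
  (λ e D i → [ c e D , c' e D ]′ (∈-++⁻ L i))

module _ {L : List Form} (cl : Closed L) where

  open Closed cl

  legit-agree : ∀ {g s} → Agree L g s → Legit L s → Legit L g
  legit-agree a (mkLegit l₁ l₂) = mkLegit
    (λ e D i → trans (a (at-■ D) i) (trans (l₁ (back e) D i) (sym (a (at-□ D) (■-□ i)))))
    (λ e D i d → trans (a (at-■ D) i) (l₂ (back e) D i d))
    where
    back : ∀ {b} → _ ≡ b → _ ≡ b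
    back = trans (sym (a (at-□ ⊥') □⊥∈))

  succ-agree : ∀ {f t g s} → Agree L f t → Agree L g s → Succ L t s → Succ L f g
  succ-agree a b (mkSucc l g₁ g₂) = mkSucc
    (legit-agree b l)
    (λ E i e → let x , y = g₁ E i (trans (sym (a (at-□ E) i)) e) in
      trans (b (at-□ E) i) x , trans (cov-agree b E (□-cov i)) y)
    (λ e D i → let x , y = g₂ (trans (sym (b (at-□ ⊥') □⊥∈)) e) D i in
      (λ e' → trans (b (at-■ D) i) (x (trans (sym (a (at-□ D) (■-□ i))) e'))) ,
      (λ e' → trans (b (at-■ D) i) (y (trans (sym (a (at-□ (¬' D)) (■-□¬ i))) e'))))

-- Extends `leaf-thm` to every theorem: if `■ D` is not listed, the default value of types applies.
legit-thm : ∀ {L t D} → t ∈ types L → Legit L t → t (□ ⊥') ≡ true → ⊢ D → t (■ D) ≡ true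
legit-thm {L} {t} {D} i l e d with (■ D) ∈? L
... | yes j = leaf-thm l e D j d
... | no n = types-default L i n

module _ (L₁ L₂ : List Form) (nm₁ nm₂ : Val → Form) (t u : Val)
  (◇₁ : ◇-Rule L₁ nm₁ t) (□₂ : □-Rule L₂ nm₂ u)
  (succ₁? : ∀ r → Dec (Succ L₁ t r)) (succ₂? : ∀ v → Dec (Succ L₂ u v)) where

  -- If every eligible pair is refuted, `nm₁ t` yields a possible disjunction of witnesses while
  -- `nm₂ u` makes its negation necessary. Side 1 owns the false box, and the two sides can be
  -- exchanged.
  search : ∀ {E} → □ E ∈ L₁ → t (□ E) ≡ false → {X : Val → Val → Set} →
    (∀ r v → r ∈ types L₁ → v ∈ types L₂ → Succ L₁ t r → Succ L₂ u v → r (□ E) ≡ true →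
      (⊢ nm₁ r ⇒ ¬' nm₂ v) ⊎ X r v) →
    (⊢ nm₁ t ⇒ ¬' nm₂ u) ⊎
    Σ Val λ r → Σ Val λ v → Succ L₁ t r × Succ L₂ u v × ⟦ r ⟧ E ≡ false × X r v
  search {E} i e {X} h = [ inj₁ ∘ refuted , inj₂ ]′ (∀∈? (types L₁) inspect)
    where
    OK : Val → Set
    OK r = Succ L₁ t r × r (□ E) ≡ true × ⟦ r ⟧ E ≡ false

    ok? : ∀ r → Dec (OK r)
    ok? r = succ₁? r ×-dec (r (□ E) Boolₚ.≟ true) ×-dec (⟦ r ⟧ E Boolₚ.≟ false)

    Found : Set
    Found = Σ Val λ r → Σ Val λ v → Succ L₁ t r × Succ L₂ u v × ⟦ r ⟧ E ≡ false × X r v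

    inspect : ∀ r → r ∈ types L₁ →
      (OK r → ∀ v → v ∈ types L₂ → Succ L₂ u v → ⊢ nm₁ r ⇒ ¬' nm₂ v) ⊎ Found
    inspect r j with ok? r
    ... | no n = inj₁ λ ok → ⊥-elim (n ok)
    ... | yes (g , y , n) = [ (λ k → inj₁ λ _ → k) , inj₂ ]′ (∀∈? (types L₂) inner)
      where
      inner : ∀ v → v ∈ types L₂ → (Succ L₂ u v → ⊢ nm₁ r ⇒ ¬' nm₂ v) ⊎ Found
      inner v k with succ₂? v
      ... | no m = inj₁ λ g' → ⊥-elim (m g')
      ... | yes g' = [ (λ p → inj₁ λ _ → p) , (λ x → inj₂ (r , v , g , g' , n , x)) ]′ (h r v j k g g' y)

    refuted : (∀ r → r ∈ types L₁ → OK r → ∀ v → v ∈ types L₂ → Succ L₂ u v → ⊢ nm₁ r ⇒ ¬' nm₂ v) →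
      ⊢ nm₁ t ⇒ ¬' nm₂ u
    refuted k = prop₂
      (◇₁ E i e Z λ r j g y n → prop (⇒i λ x → ⋁-intro j (guard-intro (ok? r) (g , y , n) x)))
      (□₂ (¬' Z) λ v j g → contrapose (⋁-rule (types L₁) λ r j' → guard-rule (ok? r) λ ok → k r j' ok v j g))
      λ a b → ⇒i λ x → ¬i λ y → ¬e (⇒e a x) (⇒e b y)
      where
      Z : Form
      Z = ⋁ (types L₁) λ r → guard (ok? r) (nm₁ r)

-- Types take the value true outside their list of atoms, so for compatible types
-- the pointwise conjunction extends both.
_⊓_ : Val → Val → Val
(t ⊓ u) F = t F ∧ u F

-- `nm-lit` concerns shared atoms only: an interpolant fixes just the P-free atoms, and the second
-- list will contain no others.
module Joint
  {L₁ : List Form} (cl₁ : Closed L₁) (thm₁? : ∀ D → ■ D ∈ L₁ → Dec (⊢ D))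
  {L₂ : List Form} (cl₂ : Closed L₂) (thm₂? : ∀ D → ■ D ∈ L₂ → Dec (⊢ D))
  (nm : Val → Form)
  (nm-□ : ∀ t → t ∈ types L₁ → □-Rule L₁ nm t)
  (nm-◇ : ∀ t → t ∈ types L₁ → ◇-Rule L₁ nm t)
  (nm-lit : ∀ t → t ∈ types L₁ → ∀ F → F ∈ L₁ → F ∈ L₂ → ⊢ nm t ⇒ lit (t F) F)
  where

  module R₁ = Refutation cl₁ thm₁?
  module R₂ = Refutation cl₂ thm₂?

  L : List Form
  L = L₁ ++ L₂

  Compat : Val → Val → Set
  Compat t u = ∀ F → F ∈ L₁ → F ∈ L₂ → t F ≡ u F

  rank₁ rank₂ : Val → ℕ
  rank₁ = rank (□B.bodies L₁)
  rank₂ = rank (□B.bodies L₂)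

  compat? : ∀ t u → t ∈ types L₁ → Compat t u ⊎ (⊢ nm t ⇒ ¬' dsc L₂ u)
  compat? t u i = ∀∈? L₁ test
    where
    test : ∀ F → F ∈ L₁ → (F ∈ L₂ → t F ≡ u F) ⊎ (⊢ nm t ⇒ ¬' dsc L₂ u)
    test F j with F ∈? L₂ | t F Boolₚ.≟ u F
    ... | no n | _ = inj₁ λ k → ⊥-elim (n k)
    ... | yes k | yes e = inj₁ λ _ → e
    ... | yes k | no n = inj₂ (prop₁ (nm-lit t i F j k) λ a → ⇒i λ x → ¬i λ y →
      n (trans (sym (lit-elim (t F) F (⇒e a x))) (dsc-elim y k)))

  module _ {t u : Val} (i : t ∈ types L₁) (j : u ∈ types L₂) (c : Compat t u) where

    agree₁ : Agree L₁ (t ⊓ u) t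
    agree₁ {G} _ k with G ∈? L₂
    ... | yes l = trans (cong (t G ∧_) (sym (c G k l))) (Boolₚ.∧-idem (t G))
    ... | no n = trans (cong (t G ∧_) (types-default L₂ j n)) (Boolₚ.∧-identityʳ (t G))

    agree₂ : Agree L₂ (t ⊓ u) u
    agree₂ {G} _ k with G ∈? L₁
    ... | yes l = trans (cong (_∧ u G) (c G l k)) (Boolₚ.∧-idem (u G))
    ... | no n = cong (_∧ u G) (types-default L₁ i n)

  Joint : Val → Val → Set
  Joint t u = Compat t u × Realized L (t ⊓ u)

  -- Induction on the sum of the ranks, bounded by `n`. For each false box `search` supplies a pair
  -- of successors: the rank falls strictly on the side owning the box and does not grow on the
  -- other. The resulting joint trees become the children of the new root.
  joint : ∀ n t u → t ∈ types L₁ → u ∈ types L₂ → Legit L₁ t → Legit L₂ u →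
    rank₁ t + rank₂ u < n → (⊢ nm t ⇒ ¬' dsc L₂ u) ⊎ Joint t u
  joint-compat : ∀ n t u → t ∈ types L₁ → u ∈ types L₂ → Legit L₁ t → Legit L₂ u →
    rank₁ t + rank₂ u ≤ n → Compat t u → (⊢ nm t ⇒ ¬' dsc L₂ u) ⊎ Joint t u

  joint (suc n) t u i j lt lu (s≤s b) =
    [ joint-compat n t u i j lt lu b , inj₁ ]′ (compat? t u i)

  joint-compat n t u i j lt lu b c = [ (λ w → inj₂ (c , realize w)) , inj₁ ]′
    (∀∈? (□B.bodies L) λ E k → [ at₁ E , at₂ E ]′ (∈-++⁻ L₁ (□B.∈-bodies⁻ L k)))
    where
    s : Val
    s = t ⊓ u

    Witness : Form → Set
    Witness E = Σ Val λ r → Succ L s r × ⟦ r ⟧ E ≡ false × Realized L r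

    Found : Val → Val → Set
    Found r v = r ∈ types L₁ × v ∈ types L₂ × Joint r v

    found : ∀ {r v} → Succ L₁ t r → Succ L₂ u v → Found r v → Succ L s (r ⊓ v)
    found g h (k , l , d , _) = succ-++ L₁
      (succ-agree cl₁ (agree₁ i j c) (agree₁ k l d) g)
      (succ-agree cl₂ (agree₂ i j c) (agree₂ k l d) h)

    recurse : ∀ r v → r ∈ types L₁ → v ∈ types L₂ → Succ L₁ t r → Succ L₂ u v →
      rank₁ r + rank₂ v < rank₁ t + rank₂ u → (⊢ nm r ⇒ ¬' dsc L₂ v) ⊎ Found r v
    recurse r v k l g h lt =
      [ inj₁ , (λ x → inj₂ (k , l , x)) ]′ (joint n r v k l (legit g) (legit h) (ℕₚ.<-≤-trans lt b))

    Outcome : Form → Set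
    Outcome E = (s (□ E) ≡ false → Witness E) ⊎ (⊢ nm t ⇒ ¬' dsc L₂ u)

    at₁ : ∀ E → □ E ∈ L₁ → Outcome E
    at₁ E k = [ (λ e → inj₁ λ e' → ⊥-elim (true≢false (trans (agree₁ i j c (at-□ E) k) e) e')) , go ]′
      (bool (t (□ E)))
      where
      pack : (Σ Val λ r → Σ Val λ v → Succ L₁ t r × Succ L₂ u v × ⟦ r ⟧ E ≡ false × Found r v) → Witness E
      pack (r , v , g , h , ne , x@(k' , l , d , real)) = r ⊓ v , found g h x ,
        trans (cov-agree (agree₁ k' l d) E (Closed.□-cov cl₁ k)) ne , real
      go : t (□ E) ≡ false → Outcome E
      go e = [ inj₂ , (λ x → inj₁ λ _ → pack x) ]′
        (search L₁ L₂ nm (dsc L₂) t u (nm-◇ t i) (R₂.dsc-□ u)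
          (λ r → toDec (R₁.succ? t r)) (λ v → toDec (R₂.succ? u v)) k e {Found}
          λ r v k' l g h y → recurse r v k' l g h (ℕₚ.+-mono-<-≤ (succ-rank-< g k e y) (succ-rank-≤ h)))

    at₂ : ∀ E → □ E ∈ L₂ → Outcome E
    at₂ E k = [ (λ e → inj₁ λ e' → ⊥-elim (true≢false (trans (agree₂ i j c (at-□ E) k) e) e')) , go ]′
      (bool (u (□ E)))
      where
      pack : (Σ Val λ v → Σ Val λ r → Succ L₂ u v × Succ L₁ t r × ⟦ v ⟧ E ≡ false × Found r v) → Witness E
      pack (v , r , h , g , ne , x@(k' , l , d , real)) = r ⊓ v , found g h x ,
        trans (cov-agree (agree₂ k' l d) E (Closed.□-cov cl₂ k)) ne , real
      go : u (□ E) ≡ false → Outcome E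
      go e = [ (λ p → inj₂ (contrapose p)) , (λ x → inj₁ λ _ → pack x) ]′
        (search L₂ L₁ (dsc L₂) nm u t (R₂.dsc-◇ u) (nm-□ t i)
          (λ v → toDec (R₂.succ? u v)) (λ r → toDec (R₁.succ? t r)) k e {λ v r → Found r v}
          λ v r l k' h g y → [ (λ p → inj₁ (contrapose p)) , inj₂ ]′
            (recurse r v k' l g h (ℕₚ.+-mono-≤-< (succ-rank-≤ g) (succ-rank-< h k e y))))

    realize : (∀ E → E ∈ □B.bodies L → s (□ E) ≡ false → Witness E) → Realized L s
    realize w = Build.build (closed-++ cl₁ cl₂)
      (legit-++ L₁ (legit-agree cl₁ (agree₁ i j c) lt) (legit-agree cl₂ (agree₂ i j c) lu))
      (λ e D d → let e₁ , e₂ = ∧-elim e in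
        ∧-intro (legit-thm {L₁} i lt e₁ d) (legit-thm {L₂} j lu e₂ d))
      (λ E k → w E (□B.∈-bodies⁺ k))

  Countermodel : Form → Form → Set
  Countermodel A B = Σ Tree λ M → RootOK M × ev nothing M A ≡ true × ev nothing M B ≡ false

  -- The types `u` for `B` are exhaustive. Illegitimate ones and those satisfying `B` are settled by
  -- derivations; for the others `joint` yields either inconsistency with `nm t` or a countermodel.
  derive : ∀ {A B} → Cov L₁ A → Cov L₂ B → ∀ t → t ∈ types L₁ → Legit L₁ t → ⟦ t ⟧ A ≡ true →
    (⊢ nm t ⇒ B) ⊎ Countermodel A B
  derive {A} {B} cA cB t i lt a =
    [ (λ h → inj₁ (prop₁ (cover L₂ h) id)) , inj₂ ]′ (∀∈? (types L₂) test)
    where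
    Outcome : Val → Set
    Outcome u = (⊢ dsc L₂ u ⇒ nm t ⇒ B) ⊎ Countermodel A B

    refuted : ∀ {u} → u ∈ types L₂ → ⟦ u ⟧ B ≡ false → (⊢ nm t ⇒ ¬' dsc L₂ u) ⊎ Joint t u → Outcome u
    refuted j e (inj₁ p) = inj₁ (prop₁ p λ q → ⇒i λ y → ⇒i λ x → ⊥-elim (¬e (⇒e q x) y))
    refuted j e (inj₂ (c , M , real , ok)) = inj₂ (M , ok ,
      trans (real A (cov-mono ∈-++⁺ˡ A cA)) (trans (cov-agree (agree₁ i j c) A cA) a) ,
      trans (real B (cov-mono (∈-++⁺ʳ L₁) B cB)) (trans (cov-agree (agree₂ i j c) B cB) e))

    split : ∀ u → u ∈ types L₂ → DecR (Legit L₂ u) (⊢ ¬' dsc L₂ u) → ⟦ u ⟧ B ≡ true ⊎ ⟦ u ⟧ B ≡ false → Outcome u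
    split u j (inj₂ (_ , x)) _ = inj₁ (prop₁ x λ n → ⇒i λ y → ⊥-elim (¬e n y))
    split u j (inj₁ _) (inj₁ e) = inj₁ (prop₁ (dsc-decides true cB e) λ p → ⇒i λ y → ⇒i λ _ → ⇒e p y)
    split u j (inj₁ lu) (inj₂ e) = refuted j e (joint (suc (rank₁ t + rank₂ u)) t u i j lt lu ℕₚ.≤-refl)

    test : ∀ u → u ∈ types L₂ → Outcome u
    test u j = split u j (R₂.legit? u) (bool (⟦ u ⟧ B))

-- Decidability of theoremhood.

-- The joint construction with the trivially true antecedent `¬' ⊥'`, whose closure contains no `■`;
-- a countermodel excludes provability by soundness.
decide : ∀ B → (∀ D → ■ D ∈ closure B → Dec (⊢ D)) → Dec (⊢ B)
decide B thm? = [ yes ∘ cover L₁ , (λ { (M , ok , _ , e) → no λ p → true≢false (sound p nothing M ok) e }) ]′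
  (∀∈? (types L₁) test)
  where
  A : Form
  A = ¬' ⊥'
  L₁ : List Form
  L₁ = closure A
  thm₁? : ∀ D → ■ D ∈ L₁ → Dec (⊢ D)
  thm₁? D (here ())
  thm₁? D (there ())
  module R = Refutation (closure-closed A) thm₁?
  module J = Joint (closure-closed A) thm₁? (closure-closed B) thm? (dsc L₁)
    (λ t _ → R.dsc-□ t) (λ t _ → R.dsc-◇ t) (λ t _ F i _ → dsc-lit {L₁} {t} (t F) i refl)
  split : ∀ t → t ∈ types L₁ → DecR (Legit L₁ t) (⊢ ¬' dsc L₁ t) → (⊢ dsc L₁ t ⇒ B) ⊎ J.Countermodel A B
  split t i (inj₂ (_ , x)) = inj₁ (prop₁ x λ n → ⇒i λ y → ⊥-elim (¬e n y))
  split t i (inj₁ l) = J.derive {A} (closure-cov A) (closure-cov B) t i l refl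
  test : ∀ t → t ∈ types L₁ → (⊢ dsc L₁ t ⇒ B) ⊎ J.Countermodel A B
  test t i = split t i (R.legit? t)

-- Legitimacy of types asks whether `D` is a theorem. The recursion is well founded because deciding
-- `D` only asks about black boxes inside `D`.
thm? : ∀ A D → ■ D ∈ atoms A → Dec (⊢ D)
thm? (var p) D (here ())
thm? (¬' A) D i = thm? A D i
thm? (A ∨' B) D i = [ thm? A D , thm? B D ]′ (∈-++⁻ (atoms A) i)
thm? (□ A) D (there i) = thm? A D i
thm? (■ A) .A (here refl) = decide A λ { D (there i) → thm? A D i }
thm? (■ A) D (there (there (there i))) = thm? A D i

closure-thm? : ∀ A D → ■ D ∈ closure A → Dec (⊢ D)
closure-thm? A D (there i) = thm? A D i

-- Interpolants of types

Avoids : List ℕ → Form → Set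
Avoids P F = ∀ p → p occursIn F → p ∉ P

avoids? : ∀ P F → Dec (Avoids P F)
avoids? P (var q) = map′ (λ { n _ here → n }) (λ h → h q here) (¬? (DecMembership._∈?_ ℕₚ._≟_ q P))
avoids? P ⊥' = yes λ _ ()
avoids? P (¬' A) = map′ (λ { h p (in¬ o) → h p o }) (λ h p o → h p (in¬ o)) (avoids? P A)
avoids? P (A ∨' B) = map′
  (λ { (h , k) p (in∨ˡ o) → h p o ; (h , k) p (in∨ʳ o) → k p o })
  (λ h → (λ p o → h p (in∨ˡ o)) , (λ p o → h p (in∨ʳ o)))
  (avoids? P A ×-dec avoids? P B)
avoids? P (□ A) = map′ (λ { h p (in□ o) → h p o }) (λ h p o → h p (in□ o)) (avoids? P A)
avoids? P (■ A) = map′ (λ { h p (in■ o) → h p o }) (λ h p o → h p (in■ o)) (avoids? P A)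

pick : {Q : Set} → Dec Q → Form → Form → Form
pick (yes _) A B = A
pick (no _) A B = B

pick-yes : ∀ {Q : Set} (d : Dec Q) {A B} → Q → pick d A B ≡ A
pick-yes (yes _) q = refl
pick-yes (no n) q = ⊥-elim (n q)

pick-no : ∀ {Q : Set} (d : Dec Q) {A B} → ¬ Q → pick d A B ≡ B
pick-no (yes q) n = ⊥-elim (n q)
pick-no (no _) n = refl

module Interpolants {L : List Form} (cl : Closed L) (thm? : ∀ D → ■ D ∈ L → Dec (⊢ D)) (P : List ℕ) where

  open Refutation cl thm?

  rk : Val → ℕ
  rk = rank (□B.bodies L)

  Allowed : ℕ → Set
  Allowed p = Σ Form λ F → F ∈ L × Avoids P F × p occursIn F

  -- `literal`, `box` and `dia` are what `Joint` asks of names of types; `allowed` gives the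
  -- variable condition, and `implied` gives provability from `A`.
  record Interpolates (e : Val → Form) (t : Val) : Set where
    field
      allowed : ∀ {p} → p occursIn e t → Allowed p
      implied : ⊢ dsc L t ⇒ e t
      literal : ∀ F → F ∈ L → Avoids P F → ⊢ e t ⇒ lit (t F) F
      box : □-Rule L e t
      dia : ◇-Rule L e t

  open Interpolates

  OK : Val → Form → Val → Set
  OK t E r = Succ L t r × r (□ E) ≡ true × ⟦ r ⟧ E ≡ false

  ok? : ∀ t E r → Dec (OK t E r)
  ok? t E r = toDec (succ? t r) ×-dec (r (□ E) Boolₚ.≟ true) ×-dec (⟦ r ⟧ E Boolₚ.≟ false)

  falses : Val → List Form
  falses t = filter (λ E → t (□ E) Boolₚ.≟ false) (□B.bodies L)

  free : List Form
  free = filter (avoids? P) L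

  module Step (k : ℕ) (e : Val → Form)
    (ih : ∀ t → t ∈ types L → rk t < k → Interpolates e t) where

    literals : Val → Form
    literals t = ⋀ free λ F → lit (t F) F

    refuter : Val → Form → Form
    refuter t E = ⋁ (types L) λ r → guard (ok? t E r) (e r)

    refuters : Val → Form
    refuters t = ⋀ (falses t) λ E → ◇ refuter t E

    core : Val → Form
    core t = literals t ∧' refuters t

    above : Val → Form
    above s = pick (rk s <? k) (e s) (core s)

    successors : Val → Form
    successors t = ⋁ (types L) λ s → guard (toDec (succ? t s)) (above s)

    new : Val → Form
    new t = core t ∧' □ successors t

    e′ : Val → Form
    e′ t = pick (rk t <? k) (e t) (new t)

    -- The box `□ E` turns from false to true, so the formulas already constructed cover the
    -- witnesses even of a type of rank exactly `k`.
    refuter-rank : ∀ {t E r} → rk t ≤ k → E ∈ falses t → OK t E r → rk r < k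
    refuter-rank {t} b m (g , y , _) =
      let i , f = ∈-filter⁻ (λ E → t (□ E) Boolₚ.≟ false) m in
      ℕₚ.<-≤-trans (succ-rank-< g (□B.∈-bodies⁻ L i) f y) b

    refuter-intro : ∀ {t E r} → r ∈ types L → OK t E r → ⊢ e r ⇒ refuter t E
    refuter-intro {t} {E} {r} j ok = prop (⇒i λ x → ⋁-intro j (guard-intro (ok? t E r) ok x))

    core-implied : ∀ t → rk t ≤ k → ⊢ dsc L t ⇒ core t
    core-implied t b = ⊢∧
      (⋀-rule free λ F m → dsc-lit (t F) (proj₁ (∈-filter⁻ (avoids? P) {xs = L} m)) refl)
      (⋀-rule (falses t) λ E m →
        let i , f = ∈-filter⁻ (λ E → t (□ E) Boolₚ.≟ false) {xs = □B.bodies L} m in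
        dsc-◇ t E (□B.∈-bodies⁻ L i) f (refuter t E) λ r j g y n →
          implied (ih r j (refuter-rank b m (g , y , n))) ⟫ refuter-intro j (g , y , n))

    core-allowed : ∀ {p} t → rk t ≤ k → p occursIn core t → Allowed p
    core-allowed {p} t b o = [ lits , refs ]′ (occurs-∧ o)
      where
      lits : p occursIn literals t → Allowed p
      lits o = let F , m , o′ = occurs-⋀ free o ; i , a = ∈-filter⁻ (avoids? P) {xs = L} m in
        F , i , a , occurs-lit (t F) o′
      inner : ∀ {E} → E ∈ falses t → p occursIn (◇ refuter t E) → Allowed p
      inner {E} m (in¬ (in□ (in¬ o))) =
        let r , j , o₁ = occurs-⋁ (types L) o ; ok , o₂ = occurs-guard (ok? t E r) o₁ in
        allowed (ih r j (refuter-rank b m ok)) o₂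
      refs : p occursIn refuters t → Allowed p
      refs o = let E , m , o′ = occurs-⋀ (falses t) o in inner m o′

    above-implied : ∀ s → s ∈ types L → rk s ≤ k → (d : Dec (rk s < k)) →
      ⊢ dsc L s ⇒ pick d (e s) (core s)
    above-implied s i b (yes l) = implied (ih s i l)
    above-implied s i b (no _) = core-implied s b

    above-allowed : ∀ {p} s → s ∈ types L → rk s ≤ k → (d : Dec (rk s < k)) →
      p occursIn pick d (e s) (core s) → Allowed p
    above-allowed s i b (yes l) = allowed (ih s i l)
    above-allowed s i b (no _) = core-allowed s b

    new-allowed : ∀ {p} t → rk t ≤ k → p occursIn new t → Allowed p
    new-allowed {p} t b o = [ core-allowed t b , box-part ]′ (occurs-∧ o)
      where
      box-part : p occursIn (□ successors t) → Allowed p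
      box-part (in□ o) =
        let s , i , o₁ = occurs-⋁ (types L) o
            g , o₂ = occurs-guard (toDec (succ? t s)) o₁
        in above-allowed s i (ℕₚ.≤-trans (succ-rank-≤ g) b) (rk s <? k) o₂

    new-implied : ∀ t → rk t ≤ k → ⊢ dsc L t ⇒ new t
    new-implied t b = ⊢∧ (core-implied t b) (dsc-□ t (successors t) λ s i g →
      above-implied s i (ℕₚ.≤-trans (succ-rank-≤ g) b) (rk s <? k) ⟫
      prop (⇒i λ x → ⋁-intro i (guard-intro (toDec (succ? t s)) g x)))

    -- A successor of the same rank satisfies the same boxes, so it has the same successors.
    succ-transfer : ∀ {t s r} → Succ L t s → rk t ≤ rk s → Succ L t r → Succ L s r
    succ-transfer {t} {s} {r} g b h = mkSucc (legit h)
      (λ E i y → step□ h E i (back i y))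
      (λ y D i → let p , q = leaf■-forced h y D i in
        (λ z → p (back (Closed.■-□ cl i) z)) , (λ z → q (back (Closed.■-□¬ cl i) z)))
      where
      back : ∀ {E} → □ E ∈ L → s (□ E) ≡ true → t (□ E) ≡ true
      back {E} i y = [ id , (λ n → ⊥-elim (ℕₚ.<⇒≱ (succ-rank-< g i n y) b)) ]′ (bool (t (□ E)))

    -- The disjuncts `above r` do not depend on the type below them; only the guards do, and
    -- `succ-transfer` moves those.
    successors-transfer : ∀ {t s} → Succ L t s → rk t ≤ rk s → ⊢ successors t ⇒ successors s
    successors-transfer {t} {s} g b = prop (⇒i λ z →
      let r , i , x = ⋁-elim (types L) z ; h , y = guard-elim (toDec (succ? t r)) x in
      ⋁-intro i (guard-intro (toDec (succ? s r)) (succ-transfer g b h) y))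

    -- From □Z follows □(Z ∧ □Z), and □Z completes the truncated disjuncts of Z.
    new-box : ∀ t → rk t ≡ k → ∀ G → (∀ s → s ∈ types L → Succ L t s → ⊢ e′ s ⇒ G) → ⊢ new t ⇒ □ G
    new-box t refl G h = □-map₂ (⋁-rule (types L) λ s i → guard-rule (toDec (succ? t s)) λ g →
        disjunct s g (rk s <? k) (h s i g)) □Z (□Z ⟫ □-trans)
      where
      □Z : ⊢ new t ⇒ □ successors t
      □Z = prop (⇒i ∧e₂)
      disjunct : ∀ s → Succ L t s → (d : Dec (rk s < k)) → ⊢ pick d (e s) (new s) ⇒ G →
        ⊢ pick d (e s) (core s) ⇒ □ successors t ⇒ G
      disjunct s g (yes _) p = prop₁ p λ a → ⇒i λ x → ⇒i λ _ → ⇒e a x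
      disjunct s g (no n) p = prop₂ p (mp axK (nec□ (successors-transfer g (ℕₚ.≮⇒≥ n))))
        λ a q → ⇒i λ x → ⇒i λ z → ⇒e a (∧i x (⇒e q z))

    old : ∀ t → rk t < k → e′ t ≡ e t
    old t = pick-yes (rk t <? k)

    ⊢old : ∀ {G} t → rk t < k → ⊢ e′ t ⇒ G → ⊢ e t ⇒ G
    ⊢old t l = subst (λ X → ⊢ X ⇒ _) (old t l)

    -- Successors never have larger rank, so the rules at `t` only meet types whose formula is
    -- unchanged.
    old-step : ∀ t → t ∈ types L → rk t < k → Interpolates e′ t
    old-step t i l = record
      { allowed = λ o → allowed I (subst (_ occursIn_) eq o)
      ; implied = subst (λ X → ⊢ dsc L t ⇒ X) (sym eq) (implied I)
      ; literal = λ F j a → ⊢new (literal I F j a)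
      ; box = λ G h → ⊢new (box I G λ s j g → ⊢old s (ℕₚ.≤-<-trans (succ-rank-≤ g) l) (h s j g))
      ; dia = λ E j f G h → ⊢new (dia I E j f G λ r m g y n →
          ⊢old r (ℕₚ.≤-<-trans (succ-rank-≤ g) l) (h r m g y n))
      }
      where
      I : Interpolates e t
      I = ih t i l
      eq : e′ t ≡ e t
      eq = old t l
      ⊢new : ∀ {G} → ⊢ e t ⇒ G → ⊢ e′ t ⇒ G
      ⊢new = subst (λ X → ⊢ X ⇒ _) (sym eq)

    new-step : ∀ t → rk t ≡ k → Interpolates e′ t
    new-step t b = record
      { allowed = λ o → new-allowed t le (subst (_ occursIn_) eq o)
      ; implied = subst (λ X → ⊢ dsc L t ⇒ X) (sym eq) (new-implied t le)
      ; literal = λ F j a → ⊢new (prop (⇒i λ x → ⋀-elim (∧e₁ (∧e₁ x)) (∈-filter⁺ (avoids? P) j a)))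
      ; box = λ G h → ⊢new (new-box t b G h)
      ; dia = λ E j f G h → ⊢new (diamond E j f G h)
      }
      where
      le : rk t ≤ k
      le = ℕₚ.≤-reflexive b
      eq : e′ t ≡ new t
      eq = pick-no (rk t <? k) λ l → ℕₚ.<-irrefl b l
      ⊢new : ∀ {G} → ⊢ new t ⇒ G → ⊢ e′ t ⇒ G
      ⊢new = subst (λ X → ⊢ X ⇒ _) (sym eq)
      diamond : ∀ E → □ E ∈ L → t (□ E) ≡ false → ∀ G →
        (∀ r → r ∈ types L → Succ L t r → r (□ E) ≡ true → ⟦ r ⟧ E ≡ false → ⊢ e′ r ⇒ G) → ⊢ new t ⇒ ◇ G
      -- If `□ (¬' G)` held, all Löb witnesses in `refuter t E` would be excluded, against the
      -- conjunct of `core t` for `E`.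
      diamond E j f G h = prop₁ □¬ λ q → ⇒i λ x → ¬i λ n → ¬e (⋀-elim (∧e₂ (∧e₁ x)) m) (⇒e q n)
        where
        m : E ∈ falses t
        m = ∈-filter⁺ (λ E → t (□ E) Boolₚ.≟ false) (□B.∈-bodies⁺ j) f
        □¬ : ⊢ □ (¬' G) ⇒ □ (¬' refuter t E)
        □¬ = mp axK (nec□ (contrapose (⋁-rule (types L) (λ r i → guard-rule (ok? t E r) λ ok@(g , y , n) →
          ⊢old r (refuter-rank le m ok) (h r i g y n)) ⟫ prop (⇒i λ a → ¬i λ b → ¬e b a))))

  interpolants : ∀ k → Σ (Val → Form) λ e → ∀ t → t ∈ types L → rk t < k → Interpolates e t
  interpolants zero = (λ _ → ⊥') , λ _ _ ()
  interpolants (suc k) =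
    let e , ih = interpolants k
        open Step k e ih
    in e′ , λ { t i (s≤s b) → [ old-step t i , new-step t ]′ (ℕₚ.m≤n⇒m<n∨m≡n b) }

  interpolant : Σ (Val → Form) λ e → ∀ t → t ∈ types L → Interpolates e t
  -- A rank is at most the number of listed boxes, so one more stage than that number reaches every
  -- type.
  interpolant = let e , h = interpolants (suc (length (□B.bodies L))) in
    e , λ t i → h t i (s≤s (rank-bound (□B.bodies L) t))

-- The uniform interpolant of a formula.

theorem6p6 : (A : Form) (P : List ℕ) →
    Σ Form (λ C →
    (∀ p → p occursIn C → p occursIn A × p ∉ P)
    × GR° (A ⇒ C)
    × (∀ B → GR° (A ⇒ B) → (∀ p → p occursIn B → p ∉ P) → GR° (C ⇒ B)))
theorem6p6 A P = C , C-occurs , A⇒C , C⇒B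
  where
  L : List Form
  L = closure A
  module R = Refutation (closure-closed A) (closure-thm? A)
  module I = Interpolants (closure-closed A) (closure-thm? A) P
  module E = I.Interpolates

  e : Val → Form
  e = proj₁ I.interpolant

  spec : ∀ t → t ∈ types L → I.Interpolates e t
  spec = proj₂ I.interpolant

  ok? : ∀ t → Dec (Legit L t × ⟦ t ⟧ A ≡ true)
  ok? t = toDec (R.legit? t) ×-dec (⟦ t ⟧ A Boolₚ.≟ true)

  C : Form
  C = ⋁ (types L) λ t → guard (ok? t) (e t)

  C-occurs : ∀ p → p occursIn C → p occursIn A × p ∉ P
  C-occurs p o =
    let t , i , o₁ = occurs-⋁ (types L) o
        _ , o₂ = occurs-guard (ok? t) o₁
        F , j , a , o₃ = E.allowed (spec t i) o₂
    in occurs-closure A j o₃ , a p o₃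

  A⇒C : ⊢ A ⇒ C
  A⇒C = cover L λ t i → go t i (R.legit? t) (bool (⟦ t ⟧ A))
    where
    go : ∀ t → t ∈ types L → DecR (Legit L t) (⊢ ¬' dsc L t) → ⟦ t ⟧ A ≡ true ⊎ ⟦ t ⟧ A ≡ false →
      ⊢ dsc L t ⇒ A ⇒ C
    go t i (inj₂ (_ , x)) _ = prop₁ x λ n → ⇒i λ y → ⊥-elim (¬e n y)
    go t i (inj₁ l) (inj₁ a) = prop₁ (E.implied (spec t i)) λ p → ⇒i λ x → ⇒i λ _ →
      ⋁-intro i (guard-intro (ok? t) (l , a) (⇒e p x))
    go t i (inj₁ l) (inj₂ n) = prop₁ (dsc-decides false (closure-cov A) n) λ p → ⇒i λ x → ⇒i λ a →
      ⊥-elim (¬e (⇒e p x) a)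

  C⇒B : ∀ B → ⊢ A ⇒ B → (∀ p → p occursIn B → p ∉ P) → ⊢ C ⇒ B
  C⇒B B p avoids = ⋁-rule (types L) λ t i → guard-rule (ok? t) λ (l , a) →
    [ id , (λ x → ⊥-elim (impossible x)) ]′
      (J.derive {A} {B} (closure-cov A) (closure-cov B) t i l a)
    where
    module J = Joint (closure-closed A) (closure-thm? A) (closure-closed B) (closure-thm? B) e
      (λ t i → E.box (spec t i)) (λ t i → E.dia (spec t i))
      -- An atom shared with `closure B` has only variables of `B`, hence avoids `P`, and so it is
      -- fixed by `e t`.
      (λ t i F j k → E.literal (spec t i) F j λ q o → avoids q (occurs-closure B k o))
    impossible : J.Countermodel A B → ⊥
    impossible (M , ok , a , n) = true≢false (unimp (sound p nothing M ok) a) n
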